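{- For every prime number $p\geq 5$, $$\sum_{k=0}^{\frac{p-1}{2}}\binom{2k}{k}H_{k}\equiv \begin{cases} -q_{3} \pmod p & \text{if } p\equiv 1 \pmod 3,\\ q_{3} \pmod p & \text{if } p\equiv 2 \pmod 3,\end{cases}$$ and $$\sum_{k=1}^{\lfloor \frac{p-1}{4}\rfloor}\frac{1}{4^{k}}\binom{4k}{2k}\left(2H_{2k}-H_{k}\right)\equiv \begin{cases} -(-1)^{(p-1)/2}\frac{q_{3}}{2} \pmod p & \text{if } p\equiv 1 \pmod 6,\\ (-1)^{(p-1)/2}\frac{q_{3}}{2} \pmod p & \text{if } p\equiv 5 \pmod 6.\end{cases}$$
   Context: $H_n$ denotes the $n$-th harmonic number: $H_0=0$, $H_n=1+\frac12+\cdots+\frac1n$. For a prime $p$ and an integer $a$ not divisible by $p$, $q_a=(a^{p-1}-1)/p$ is the Fermat quotient. Congruences between rational numbers are understood for rationals whose denominators are coprime to $p$. -}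

module Defs where

open import Data.Nat as ℕ using (ℕ; zero; suc; _^_; _∸_)
open import Data.Nat.Combinatorics using (_C_)
open import Data.Nat.Coprimality using (Coprime)
open import Data.Integer as ℤ using (ℤ; +_)
open import Data.Integer.Divisibility using () renaming (_∣_ to _∣ℤ_)
import Data.Rational
open import Data.Rational using (ℚ; 0ℚ; _+_; _-_; _*_; _/_; ↥_; ↧ₙ_)
open import Data.Product using (_×_)

inv : ℕ → ℚ
inv zero    = 0ℚ   -- never used (H sums over i = 1..n)
inv (suc m) = + 1 / suc m

H : ℕ → ℚ
H zero    = 0ℚ
H (suc n) = H n + inv (suc n)

ℕ→ℚ : ℕ → ℚ
ℕ→ℚ n = + n / 1

sumRange : ℕ → ℕ → (ℕ → ℚ) → ℚ
sumRange a zero    f = 0ℚ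
sumRange a (suc c) f = f a + sumRange (suc a) c f

-- sum_{k=a}^{b} f k (empty when b < a)
Σ[_⋯_] : ℕ → ℕ → (ℕ → ℚ) → ℚ
Σ[ a ⋯ b ] f = sumRange a (suc b ∸ a) f

fermatQuotient : (p a : ℕ) → ℚ
fermatQuotient zero    a = 0ℚ   -- unused: p is prime
fermatQuotient (suc m) a = (+ (a ^ m) ℤ.- + 1) / suc m

_≡_[modℚ_] : ℚ → ℚ → ℕ → Set
x ≡ y [modℚ p ] =
  Coprime (↧ₙ x) p × Coprime (↧ₙ y) p × ((+ p) ∣ℤ (↥ (x - y)))

sgn : ℕ → ℚ
sgn zero    = + 1 / 1
sgn (suc n) = Data.Rational.-_ (sgn n)

{-# OPTIONS --safe #-}
-- Write p = 2n + 1 and Hₓ(y, k) = Σ_{j=1}^k (1 − y^j)/j.  Since C(2k,k) ≡ (−4)^k C(n,k),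
-- both sums become binomial sums of H = Hₓ(0, ·) and 2 H_{2k} − H_k = Hₓ(−1, 2k), and
-- these are summed by Σ_k C(n,k) x^k Hₓ(y, k) = (1 + x)^n Hₓ(t, n), (1 + x) t = 1 + x y,
-- applied to (x, y, t) = (−4, 0, −1/3), (2, −1, −1/3) and (−2, −1, −3).
-- Let E(D) = Σ_j C(p,2j) D^j be the rational part of (1 + √D)^p.  Because
-- C(p−1,k) ≡ (−1)^k, the number F(D) = (E(D) − 1)/p satisfies
-- Hₓ(D, n) ≡ 2 (F(D) − F(1)).  As 1 + √−3 is twice a sixth root of unity,
-- E(−3) = E(1) = 4^n and (−3)^n E(−1/3) = ε 4^n with ε = ±1 for p ≡ ±1 mod 6.  Hence
-- Hₓ(−3, n) ≡ 0, and comparing with 9^n − 1 = p q₃ gives (−3)^n Hₓ(−1/3, n) ≡ −ε q₃.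
module Submission where

open import Defs
open import Algebra.Bundles using (CommutativeRing)
open import Data.Integer as ℤ using (ℤ)
import Data.Integer.Properties as ℤₚ
open import Data.Nat as ℕ using (ℕ; zero; suc; s≤s; z≤n; _≤_; _<_; _^_; _%_; _∸_) renaming (_*_ to _*ₙ_; _/_ to _/ₙ_)
open import Data.Nat.Combinatorics using (_C_; nCk+nC[k+1]≡[n+1]C[k+1])
open import Data.Nat.Coprimality as Coprimality using (Coprime; coprime-divisor)
open import Data.Nat.Divisibility using (_∣_; divides; m%n≡0⇒n∣m; n∣m⇒m%n≡0; ∣-trans; ∣1⇒≡1; ∣⇒≤)
open import Data.Nat.DivMod using (m≡m%n+[m/n]*n; m%n<n; m∣n⇒o%n%m≡o%m; m*n/n≡m; m*n/m*o≡n/o; m/n*n≤m)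
open import Data.Nat.Primality using (Prime; ¬prime[1]; prime⇒irreducible; euclidsLemma)
import Data.Nat.Properties as ℕₚ
open import Data.Nat.Tactic.RingSolver using (solve-∀)
open import Data.Product using (_×_; _,_)
open import Data.Rational as ℚ using (ℚ; _+_; -_; _*_; _-_; ½; 0ℚ; 1ℚ; toℚᵘ; _/_; ↥_; ↧_; ↧ₙ_)
import Data.Rational.Properties as ℚₚ
open import Data.Rational.Solver using (module +-*-Solver)
open import Data.Rational.Unnormalised as ℚᵘ using (mkℚᵘ)
import Data.Rational.Unnormalised.Properties as ℚᵘₚ
open import Data.Sum using (_⊎_; inj₁; inj₂; [_,_]′)
open import Function using (_∘_)
open import Relation.Binary.PropositionalEquality
  using (_≡_; refl; sym; trans; cong; cong₂; subst; subst₂; module ≡-Reasoning)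
open import Relation.Nullary using (¬_; contradiction)
open +-*-Solver using (solve; _:+_; _:*_; _:-_; :-_; con; _:=_)
open import Algebra.Properties.CommutativeSemiring.Exp
  (CommutativeRing.commutativeSemiring ℚₚ.+-*-commutativeRing) using ()
  renaming (_^_ to _↑_; ^-assocʳ to ↑-assoc; ^-distrib-* to ↑-distrib)

-- Embedding of the integers

-- The Fermat quotient of 3 divides by p, so it depends on 3^(p-1) modulo p², and arguing with
-- residues modulo p from the start would lose it. For this reason the power identities, those for
-- `E`, `F` and `fermatQuotient`, are proved exactly in ℚ, and p is divided out before anything is
-- reduced. Reduction enters through the ratio of consecutive binomial coefficients, where n acts as
-- -1/2 and 2n as -1, and through (-3)^n acting as ε. The surd √D is never adjoined: (1 + √D)^m is
-- carried as the pair of its rational coefficients, each a binomial transform, so the same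
-- summation tools serve powers and harmonic sums alike.

ℤ→ℚ : ℤ → ℚ
ℤ→ℚ z = z / 1

toℚᵘ-/ : ∀ z m → toℚᵘ (z / suc m) ℚᵘ.≃ mkℚᵘ z m
toℚᵘ-/ z m = ℚₚ.toℚᵘ-fromℚᵘ (mkℚᵘ z m)

ℤ→ℚ-+ : ∀ a b → ℤ→ℚ (a ℤ.+ b) ≡ ℤ→ℚ a + ℤ→ℚ b
ℤ→ℚ-+ a b = ℚₚ.toℚᵘ-injective (begin
  toℚᵘ (ℤ→ℚ (a ℤ.+ b))                 ≈⟨ toℚᵘ-/ (a ℤ.+ b) 0 ⟩
  mkℚᵘ (a ℤ.+ b) 0                     ≈⟨ ℚᵘ.*≡* (cong (ℤ._* ℤ.+ 1) (sym (cong₂ ℤ._+_ (ℤₚ.*-identityʳ a) (ℤₚ.*-identityʳ b)))) ⟩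
  mkℚᵘ a 0 ℚᵘ.+ mkℚᵘ b 0               ≈⟨ ℚᵘₚ.+-cong (toℚᵘ-/ a 0) (toℚᵘ-/ b 0) ⟨
  toℚᵘ (ℤ→ℚ a) ℚᵘ.+ toℚᵘ (ℤ→ℚ b)       ≈⟨ ℚₚ.toℚᵘ-homo-+ (ℤ→ℚ a) (ℤ→ℚ b) ⟨
  toℚᵘ (ℤ→ℚ a + ℤ→ℚ b)                 ∎)
  where open ℚᵘₚ.≃-Reasoning

ℤ→ℚ-* : ∀ a b → ℤ→ℚ (a ℤ.* b) ≡ ℤ→ℚ a * ℤ→ℚ b
ℤ→ℚ-* a b = ℚₚ.toℚᵘ-injective (begin
  toℚᵘ (ℤ→ℚ (a ℤ.* b))                 ≈⟨ toℚᵘ-/ (a ℤ.* b) 0 ⟩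
  mkℚᵘ a 0 ℚᵘ.* mkℚᵘ b 0               ≈⟨ ℚᵘₚ.*-cong (toℚᵘ-/ a 0) (toℚᵘ-/ b 0) ⟨
  toℚᵘ (ℤ→ℚ a) ℚᵘ.* toℚᵘ (ℤ→ℚ b)       ≈⟨ ℚₚ.toℚᵘ-homo-* (ℤ→ℚ a) (ℤ→ℚ b) ⟨
  toℚᵘ (ℤ→ℚ a * ℤ→ℚ b)                 ∎)
  where open ℚᵘₚ.≃-Reasoning

/-ℤ→ℚ : ∀ z m → ℕ→ℚ (suc m) * (z / suc m) ≡ ℤ→ℚ z
/-ℤ→ℚ z m = ℚₚ.toℚᵘ-injective (begin
  toℚᵘ (ℕ→ℚ (suc m) * (z / suc m))             ≈⟨ ℚₚ.toℚᵘ-homo-* (ℕ→ℚ (suc m)) (z / suc m) ⟩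
  toℚᵘ (ℕ→ℚ (suc m)) ℚᵘ.* toℚᵘ (z / suc m)     ≈⟨ ℚᵘₚ.*-cong (toℚᵘ-/ (ℤ.+ suc m) 0) (toℚᵘ-/ z m) ⟩
  mkℚᵘ (ℤ.+ suc m) 0 ℚᵘ.* mkℚᵘ z m               ≈⟨ ℚᵘ.*≡* (trans (ℤₚ.*-identityʳ _) (trans (ℤₚ.*-comm (ℤ.+ suc m) z) (cong (λ k → z ℤ.* ℤ.+ suc k) (sym (ℕₚ.+-identityʳ m))))) ⟩
  mkℚᵘ z 0                                     ≈⟨ toℚᵘ-/ z 0 ⟨
  toℚᵘ (ℤ→ℚ z)                                 ∎)
  where open ℚᵘₚ.≃-Reasoning

ℤ→ℚ-injective : ∀ {a b} → ℤ→ℚ a ≡ ℤ→ℚ b → a ≡ b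
ℤ→ℚ-injective {a} {b} eq with ℚᵘₚ.≃-trans (ℚᵘₚ.≃-sym (toℚᵘ-/ a 0)) (ℚᵘₚ.≃-trans (ℚᵘₚ.≃-reflexive (cong toℚᵘ eq)) (toℚᵘ-/ b 0))
... | ℚᵘ.*≡* e = trans (sym (ℤₚ.*-identityʳ a)) (trans e (ℤₚ.*-identityʳ b))

ℕ→ℚ-+ : ∀ a b → ℕ→ℚ (a ℕ.+ b) ≡ ℕ→ℚ a + ℕ→ℚ b
ℕ→ℚ-+ a b = trans (cong ℤ→ℚ (ℤₚ.pos-+ a b)) (ℤ→ℚ-+ (ℤ.+ a) (ℤ.+ b))

ℕ→ℚ-suc : ∀ a → ℕ→ℚ (suc a) ≡ 1ℚ + ℕ→ℚ a
ℕ→ℚ-suc = ℕ→ℚ-+ 1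

ℕ→ℚ-* : ∀ a b → ℕ→ℚ (a ℕ.* b) ≡ ℕ→ℚ a * ℕ→ℚ b
ℕ→ℚ-* a b = trans (cong ℤ→ℚ (ℤₚ.pos-* a b)) (ℤ→ℚ-* (ℤ.+ a) (ℤ.+ b))

inv-inverse : ∀ m → ℕ→ℚ (suc m) * inv (suc m) ≡ 1ℚ
inv-inverse m = /-ℤ→ℚ (ℤ.+ 1) m

↥≡↧* : ∀ x → ℤ→ℚ (↥ x) ≡ ℤ→ℚ (↧ x) * x
↥≡↧* x = trans (sym (/-ℤ→ℚ (↥ x) (ℚ.denominator-1 x))) (cong (ℤ→ℚ (↧ x) *_) (ℚₚ.↥p/↧p≡p x))

ℕ→ℚ-^ : ∀ a k → ℕ→ℚ (a ℕ.^ k) ≡ ℕ→ℚ a ↑ k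
ℕ→ℚ-^ a zero = refl
ℕ→ℚ-^ a (suc k) = trans (ℕ→ℚ-* a (a ℕ.^ k)) (cong (ℕ→ℚ a *_) (ℕ→ℚ-^ a k))

-- Binomial sums

sumRange-suc : ∀ a c f → sumRange (suc a) c f ≡ sumRange a c (f ∘ suc)
sumRange-suc a zero    f = refl
sumRange-suc a (suc c) f = cong (f (suc a) +_) (sumRange-suc (suc a) c f)

sumRange-head : ∀ c f → sumRange 0 (suc c) f ≡ f 0 + sumRange 0 c (f ∘ suc)
sumRange-head c f = cong (f 0 +_) (sumRange-suc 0 c f)

sumRange-cong : ∀ a c {f g} → (∀ k → f k ≡ g k) → sumRange a c f ≡ sumRange a c g
sumRange-cong a zero    eq = refl
sumRange-cong a (suc c) eq = cong₂ _+_ (eq a) (sumRange-cong (suc a) c eq)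

sumRange-+ : ∀ a c f g → sumRange a c (λ k → f k + g k) ≡ sumRange a c f + sumRange a c g
sumRange-+ a zero    f g = refl
sumRange-+ a (suc c) f g = begin
  f a + g a + sumRange (suc a) c (λ k → f k + g k)
    ≡⟨ cong (f a + g a +_) (sumRange-+ (suc a) c f g) ⟩
  f a + g a + (sumRange (suc a) c f + sumRange (suc a) c g)
    ≡⟨ solve 4 (λ x y u v → x :+ y :+ (u :+ v) := x :+ u :+ (y :+ v)) refl
         (f a) (g a) (sumRange (suc a) c f) (sumRange (suc a) c g) ⟩
  f a + sumRange (suc a) c f + (g a + sumRange (suc a) c g) ∎
  where open ≡-Reasoning

sumRange-* : ∀ x c f → sumRange 0 c (λ k → x * f k) ≡ x * sumRange 0 c f
sumRange-* x zero    f = sym (ℚₚ.*-zeroʳ x)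
sumRange-* x (suc c) f = trans (sumRange-head c (λ k → x * f k))
  (trans (cong (x * f 0 +_) (sumRange-* x c (f ∘ suc)))
  (trans (sym (ℚₚ.*-distribˡ-+ x (f 0) _)) (cong (x *_) (sym (sumRange-head c f)))))

sumRange-0 : ∀ a c {f} → (∀ k → f k ≡ 0ℚ) → sumRange a c f ≡ 0ℚ
sumRange-0 a zero    eq = refl
sumRange-0 a (suc c) eq = cong₂ _+_ (eq a) (sumRange-0 (suc a) c eq)

sumRange-snoc : ∀ a c f → sumRange a (suc c) f ≡ sumRange a c f + f (a ℕ.+ c)
sumRange-snoc a zero    f = trans (ℚₚ.+-comm (f a) 0ℚ) (cong (λ i → 0ℚ + f i) (sym (ℕₚ.+-identityʳ a)))
sumRange-snoc a (suc c) f = begin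
  f a + sumRange (suc a) (suc c) f                ≡⟨ cong (f a +_) (sumRange-snoc (suc a) c f) ⟩
  f a + (sumRange (suc a) c f + f (suc a ℕ.+ c))  ≡⟨ ℚₚ.+-assoc (f a) (sumRange (suc a) c f) (f (suc a ℕ.+ c)) ⟨
  f a + sumRange (suc a) c f + f (suc a ℕ.+ c)    ≡⟨ cong (λ i → f a + sumRange (suc a) c f + f i) (sym (ℕₚ.+-suc a c)) ⟩
  f a + sumRange (suc a) c f + f (a ℕ.+ suc c)    ∎
  where open ≡-Reasoning

2*-suc : ∀ k → 2 ℕ.* suc k ≡ suc (suc (2 ℕ.* k))
2*-suc k = cong suc (ℕₚ.+-suc k (k ℕ.+ 0))

sumRange-pairs : ∀ c f → sumRange 0 (2 ℕ.* c) f ≡ sumRange 0 c (λ k → f (2 ℕ.* k) + f (suc (2 ℕ.* k)))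
sumRange-pairs zero    f = refl
sumRange-pairs (suc c) f = begin
  sumRange 0 (2 ℕ.* suc c) f
    ≡⟨ cong (λ i → sumRange 0 i f) (2*-suc c) ⟩
  sumRange 0 (suc (suc (2 ℕ.* c))) f
    ≡⟨ sumRange-snoc 0 (suc (2 ℕ.* c)) f ⟩
  sumRange 0 (suc (2 ℕ.* c)) f + f (suc (2 ℕ.* c))
    ≡⟨ cong (_+ f (suc (2 ℕ.* c))) (sumRange-snoc 0 (2 ℕ.* c) f) ⟩
  sumRange 0 (2 ℕ.* c) f + f (2 ℕ.* c) + f (suc (2 ℕ.* c))
    ≡⟨ ℚₚ.+-assoc (sumRange 0 (2 ℕ.* c) f) (f (2 ℕ.* c)) (f (suc (2 ℕ.* c))) ⟩
  sumRange 0 (2 ℕ.* c) f + (f (2 ℕ.* c) + f (suc (2 ℕ.* c)))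
    ≡⟨ cong (_+ (f (2 ℕ.* c) + f (suc (2 ℕ.* c)))) (sumRange-pairs c f) ⟩
  sumRange 0 c g + g c
    ≡⟨ sumRange-snoc 0 c g ⟨
  sumRange 0 (suc c) g ∎
  where
  open ≡-Reasoning
  g : ℕ → ℚ
  g k = f (2 ℕ.* k) + f (suc (2 ℕ.* k))

binom : ℕ → ℕ → ℚ
binom n k = ℕ→ℚ (n C k)

binom-suc : ∀ n k → binom (suc n) (suc k) ≡ binom n k + binom n (suc k)
binom-suc n k = trans (cong ℕ→ℚ (sym (nCk+nC[k+1]≡[n+1]C[k+1] n k))) (ℕ→ℚ-+ (n C k) (n C suc k))

-- B n f is the binomial transform Σₖ C(n,k) f(k), summed by Pascal's rule.
B : ℕ → (ℕ → ℚ) → ℚ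
B zero    f = f 0
B (suc n) f = B n f + B n (f ∘ suc)

-- Any bound `M` beyond `n` is allowed since the further coefficients are zero. The slack serves
-- twice: Pascal's rule leaves its two summands with different bounds, and a sum over pairs of
-- indices may overshoot `n` by one.
B-sumRange : ∀ n M f → n < M → sumRange 0 M (λ k → binom n k * f k) ≡ B n f
B-sumRange zero (suc M) f _ = begin
  sumRange 0 (suc M) (λ k → binom 0 k * f k)
    ≡⟨ sumRange-head M (λ k → binom 0 k * f k) ⟩
  1ℚ * f 0 + sumRange 0 M (λ k → 0ℚ * f (suc k))
    ≡⟨ cong₂ _+_ (ℚₚ.*-identityˡ (f 0)) (sumRange-0 0 M (λ k → ℚₚ.*-zeroˡ (f (suc k)))) ⟩
  f 0 + 0ℚ
    ≡⟨ ℚₚ.+-identityʳ (f 0) ⟩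
  f 0 ∎
  where open ≡-Reasoning
B-sumRange (suc n) (suc M) f (s≤s n<M) = begin
  sumRange 0 (suc M) (λ k → binom (suc n) k * f k)
    ≡⟨ sumRange-head M (λ k → binom (suc n) k * f k) ⟩
  1ℚ * f 0 + sumRange 0 M (λ k → binom (suc n) (suc k) * f (suc k))
    ≡⟨ cong (1ℚ * f 0 +_) (trans (sumRange-cong 0 M pascal) (sumRange-+ 0 M (u ∘ suc) v)) ⟩
  1ℚ * f 0 + (sumRange 0 M (u ∘ suc) + sumRange 0 M v)
    ≡⟨ ℚₚ.+-assoc (1ℚ * f 0) _ _ ⟨
  1ℚ * f 0 + sumRange 0 M (u ∘ suc) + sumRange 0 M v
    ≡⟨ cong₂ _+_ (trans (sym (sumRange-head M u)) (B-sumRange n (suc M) f (ℕₚ.m≤n⇒m≤1+n n<M)))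
                 (B-sumRange n M (f ∘ suc) n<M) ⟩
  B n f + B n (f ∘ suc) ∎
  where
  open ≡-Reasoning
  u v : ℕ → ℚ
  u k = binom n k * f k
  v k = binom n k * f (suc k)
  pascal : ∀ k → binom (suc n) (suc k) * f (suc k) ≡ u (suc k) + v k
  pascal k = trans (cong (_* f (suc k)) (binom-suc n k))
    (solve 3 (λ x y z → (x :+ y) :* z := y :* z :+ x :* z) refl (binom n k) (binom n (suc k)) (f (suc k)))

B-cong : ∀ n {f g} → (∀ k → f k ≡ g k) → B n f ≡ B n g
B-cong zero    eq = eq 0
B-cong (suc n) eq = cong₂ _+_ (B-cong n eq) (B-cong n (eq ∘ suc))

B-+ : ∀ n f g → B n (λ k → f k + g k) ≡ B n f + B n g
B-+ zero    f g = refl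
B-+ (suc n) f g = trans (cong₂ _+_ (B-+ n f g) (B-+ n (f ∘ suc) (g ∘ suc)))
  (solve 4 (λ x y u v → x :+ y :+ (u :+ v) := x :+ u :+ (y :+ v)) refl
    (B n f) (B n g) (B n (f ∘ suc)) (B n (g ∘ suc)))

B-* : ∀ n x f → B n (λ k → x * f k) ≡ x * B n f
B-* zero    x f = refl
B-* (suc n) x f = trans (cong₂ _+_ (B-* n x f) (B-* n x (f ∘ suc)))
  (sym (ℚₚ.*-distribˡ-+ x (B n f) (B n (f ∘ suc))))

B-- : ∀ n f g → B n (λ k → f k - g k) ≡ B n f - B n g
B-- zero    f g = refl
B-- (suc n) f g = trans (cong₂ _+_ (B-- n f g) (B-- n (f ∘ suc) (g ∘ suc)))
  (solve 4 (λ x y u v → x :- y :+ (u :- v) := x :+ u :- (y :+ v)) refl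
    (B n f) (B n g) (B n (f ∘ suc)) (B n (g ∘ suc)))

B-↑ : ∀ n x → B n (x ↑_) ≡ (1ℚ + x) ↑ n
B-↑ zero    x = refl
B-↑ (suc n) x = trans (cong₂ _+_ (B-↑ n x) (trans (B-* n x (x ↑_)) (cong (x *_) (B-↑ n x))))
  (solve 2 (λ x y → y :+ x :* y := (con 1ℚ :+ x) :* y) refl x ((1ℚ + x) ↑ n))

-- This is k C(n+1, k) = (n+1) C(n, k-1) inside a transform. It trades the factors 1/k of a harmonic
-- sum for a single 1/(n+1) outside. Index 0 is annihilated by its factor, so `h` may safely carry
-- the default `inv 0`.
B-absorb : ∀ n h → B (suc n) (λ k → ℕ→ℚ k * h k) ≡ ℕ→ℚ (suc n) * B n (h ∘ suc)
B-absorb zero    h = solve 2 (λ x y → con 0ℚ :* x :+ con 1ℚ :* y := con 1ℚ :* y) refl (h 0) (h 1)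
B-absorb (suc n) h = begin
  B (suc n) (λ k → ℕ→ℚ k * h k) + B (suc n) (λ k → ℕ→ℚ (suc k) * h (suc k))
    ≡⟨ cong₂ _+_ (B-absorb n h) (trans (B-cong (suc n) split) (B-+ (suc n) _ (h ∘ suc))) ⟩
  ℕ→ℚ (suc n) * B n (h ∘ suc) + (B (suc n) (λ k → ℕ→ℚ k * h (suc k)) + B (suc n) (h ∘ suc))
    ≡⟨ cong (λ z → ℕ→ℚ (suc n) * B n (h ∘ suc) + (z + B (suc n) (h ∘ suc))) (B-absorb n (h ∘ suc)) ⟩
  ℕ→ℚ (suc n) * B n (h ∘ suc) + (ℕ→ℚ (suc n) * B n (h ∘ suc ∘ suc) + B (suc n) (h ∘ suc))
    ≡⟨ solve 3 (λ N x y → N :* x :+ (N :* y :+ (x :+ y)) := (con 1ℚ :+ N) :* (x :+ y)) refl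
         (ℕ→ℚ (suc n)) (B n (h ∘ suc)) (B n (h ∘ suc ∘ suc)) ⟩
  (1ℚ + ℕ→ℚ (suc n)) * B (suc n) (h ∘ suc)
    ≡⟨ cong (_* B (suc n) (h ∘ suc)) (ℕ→ℚ-suc (suc n)) ⟨
  ℕ→ℚ (suc (suc n)) * B (suc n) (h ∘ suc) ∎
  where
  open ≡-Reasoning
  split : ∀ k → ℕ→ℚ (suc k) * h (suc k) ≡ ℕ→ℚ k * h (suc k) + h (suc k)
  split k = trans (cong (_* h (suc k)) (ℕ→ℚ-suc k))
    (solve 2 (λ x y → (con 1ℚ :+ x) :* y := x :* y :+ y) refl (ℕ→ℚ k) (h (suc k)))

-- Generalised harmonic sums and their binomial transform

Hₓ : ℚ → ℕ → ℚ
Hₓ y zero    = 0ℚ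
Hₓ y (suc k) = Hₓ y k + inv (suc k) * (1ℚ - y ↑ suc k)

module _ (x y t : ℚ) (xyt : (1ℚ + x) * t ≡ 1ℚ + x * y) where
  private
    -- The correction term of `f-suc`: passing from k to k + 1 multiplies x^k Hₓ(y, k) by x and adds
    -- `d (suc k)`. At k = 0 the default `inv 0` multiplies 1 - 1, so `k*d` holds there too.
    d : ℕ → ℚ
    d k = inv k * (x ↑ k - (x * y) ↑ k)

    k*d : ∀ k → ℕ→ℚ k * d k ≡ x ↑ k - (x * y) ↑ k
    k*d zero    = refl
    k*d (suc k) = trans (sym (ℚₚ.*-assoc (ℕ→ℚ (suc k)) (inv (suc k)) _))
      (trans (cong (_* (x ↑ suc k - (x * y) ↑ suc k)) (inv-inverse k)) (ℚₚ.*-identityˡ _))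

    B-d : ∀ n → B n (d ∘ suc) ≡ inv (suc n) * ((1ℚ + x) ↑ suc n - (1ℚ + x) ↑ suc n * t ↑ suc n)
    B-d n = begin
      B n (d ∘ suc)
        ≡⟨ ℚₚ.*-identityˡ (B n (d ∘ suc)) ⟨
      1ℚ * B n (d ∘ suc)
        ≡⟨ cong (_* B n (d ∘ suc)) (trans (sym (inv-inverse n)) (ℚₚ.*-comm (ℕ→ℚ (suc n)) (inv (suc n)))) ⟩
      inv (suc n) * ℕ→ℚ (suc n) * B n (d ∘ suc)
        ≡⟨ ℚₚ.*-assoc (inv (suc n)) (ℕ→ℚ (suc n)) _ ⟩
      inv (suc n) * (ℕ→ℚ (suc n) * B n (d ∘ suc))
        ≡⟨ cong (inv (suc n) *_) (trans (sym (B-absorb n d)) (trans (B-cong (suc n) k*d) (B-- (suc n) (x ↑_) ((x * y) ↑_)))) ⟩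
      inv (suc n) * (B (suc n) (x ↑_) - B (suc n) ((x * y) ↑_))
        ≡⟨ cong₂ (λ u v → inv (suc n) * (u - v)) (B-↑ (suc n) x)
             (trans (B-↑ (suc n) (x * y)) (trans (cong (_↑ suc n) (sym xyt)) (↑-distrib (1ℚ + x) t (suc n)))) ⟩
      inv (suc n) * ((1ℚ + x) ↑ suc n - (1ℚ + x) ↑ suc n * t ↑ suc n) ∎
      where open ≡-Reasoning

  -- As (1 - y^j)/j is the integral of s^(j-1) from y to 1, `Hₓ y k` is the integral of (s^k - 1)/(s
  -- - 1) over that range. The binomial theorem turns the left side into the integral of ((1 + x
  -- s)^n - (1 + x)^n)/(s - 1), and, for x and 1 + x nonzero, the substitution 1 + x s = (1 + x) u
  -- moves the lower limit from y to t. The induction on `n` is the discrete counterpart, with `B-d`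
  -- supplying the increment; `xyt` defines t without a division.
  B-Hₓ : ∀ n → B n (λ k → x ↑ k * Hₓ y k) ≡ (1ℚ + x) ↑ n * Hₓ t n
  B-Hₓ zero    = refl
  B-Hₓ (suc n) = begin
    B n f + B n (f ∘ suc)
      ≡⟨ cong (B n f +_) (trans (B-cong n f-suc) (trans (B-+ n (λ k → x * f k) (d ∘ suc)) (cong (_+ B n (d ∘ suc)) (B-* n x f)))) ⟩
    B n f + (x * B n f + B n (d ∘ suc))
      ≡⟨ cong₂ (λ u v → u + (x * u + v)) (B-Hₓ n) (B-d n) ⟩
    A * Hₓ t n + (x * (A * Hₓ t n) + inv (suc n) * ((1ℚ + x) * A - (1ℚ + x) * A * T))
      ≡⟨ solve 5 (λ x A h i T → A :* h :+ (x :* (A :* h) :+ i :* ((con 1ℚ :+ x) :* A :- (con 1ℚ :+ x) :* A :* T))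
                   := (con 1ℚ :+ x) :* A :* (h :+ i :* (con 1ℚ :- T))) refl x A (Hₓ t n) (inv (suc n)) T ⟩
    (1ℚ + x) ↑ suc n * Hₓ t (suc n) ∎
    where
    open ≡-Reasoning
    A T : ℚ
    A = (1ℚ + x) ↑ n
    T = t ↑ suc n
    f : ℕ → ℚ
    f k = x ↑ k * Hₓ y k
    f-suc : ∀ k → f (suc k) ≡ x * f k + d (suc k)
    f-suc k = trans
      (solve 6 (λ x X h i y Y → x :* X :* (h :+ i :* (con 1ℚ :- y :* Y))
                  := x :* (X :* h) :+ i :* (x :* X :- x :* y :* (X :* Y))) refl
        x (x ↑ k) (Hₓ y k) (inv (suc k)) y (y ↑ k))
      (cong (λ z → x * f k + inv (suc k) * (x ↑ suc k - x * y * z)) (sym (↑-distrib x y k)))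

Hₓ-0 : ∀ k → Hₓ 0ℚ k ≡ H k
Hₓ-0 zero    = refl
Hₓ-0 (suc k) = cong₂ _+_ (Hₓ-0 k)
  (solve 2 (λ i z → i :* (con 1ℚ :- con 0ℚ :* z) := i) refl (inv (suc k)) (0ℚ ↑ k))

-- Rational and irrational parts of powers of 1 + √D

-- α D and β D are the coefficient sequences of √D ^ k = α D k + β D k √D.
α β : ℚ → ℕ → ℚ
α D zero          = 1ℚ
α D (suc zero)    = 0ℚ
α D (suc (suc k)) = D * α D k
β D zero    = 0ℚ
β D (suc k) = α D k

α-suc : ∀ D k → α D (suc k) ≡ D * β D k
α-suc D zero    = sym (ℚₚ.*-zeroʳ D)
α-suc D (suc k) = refl

-- (1 + √D) ^ m = E D m + O D m √D
E O : ℚ → ℕ → ℚ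
E D m = B m (α D)
O D m = B m (β D)

E-suc : ∀ D m → E D (suc m) ≡ E D m + D * O D m
E-suc D m = cong (E D m +_) (trans (B-cong m (α-suc D)) (B-* m D (β D)))

-- Multiplication by (1 + √D)^3 = (1 + 3D) + (3 + D) √D. The cube is the useful step because 3 + D
-- vanishes at D = -3 and 1 + 3D at D = -1/3.
E-3+ : ∀ D m → E D (3 ℕ.+ m) ≡ (1ℚ + ℕ→ℚ 3 * D) * E D m + D * (ℕ→ℚ 3 + D) * O D m
E-3+ D m rewrite E-suc D (2 ℕ.+ m) | E-suc D (1 ℕ.+ m) | E-suc D m =
  solve 3 (λ D e o → e :+ D :* o :+ D :* (o :+ e) :+ D :* (o :+ e :+ (e :+ D :* o))
              := (con 1ℚ :+ con (ℕ→ℚ 3) :* D) :* e :+ D :* (con (ℕ→ℚ 3) :+ D) :* o) refl D (E D m) (O D m)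

O-3+ : ∀ D m → O D (3 ℕ.+ m) ≡ (1ℚ + ℕ→ℚ 3 * D) * O D m + (ℕ→ℚ 3 + D) * E D m
O-3+ D m rewrite E-suc D (1 ℕ.+ m) | E-suc D m =
  solve 3 (λ D e o → o :+ e :+ (e :+ D :* o) :+ (e :+ D :* o :+ D :* (o :+ e))
              := (con 1ℚ :+ con (ℕ→ℚ 3) :* D) :* o :+ (con (ℕ→ℚ 3) :+ D) :* e) refl D (E D m) (O D m)

-- p-local rationals

coprime-↥↧ : ∀ x → Coprime (↧ₙ x) ℤ.∣ ↥ x ∣
coprime-↥↧ (ℚ.mkℚ n d c) = Coprimality.sym (Coprimality.recompute c)

inv-cancel : ∀ m x → inv (suc m) * (ℕ→ℚ (suc m) * x) ≡ x
inv-cancel m x = trans (solve 3 (λ i N x → i :* (N :* x) := N :* i :* x) refl (inv (suc m)) (ℕ→ℚ (suc m)) x)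
  (trans (cong (_* x) (inv-inverse m)) (ℚₚ.*-identityˡ x))

module Localization {p : ℕ} (p-prime : Prime p) where

  ¬∣⇒coprime : ∀ {d} → ¬ p ∣ d → Coprime d p
  ¬∣⇒coprime p∤d (i∣d , i∣p) with prime⇒irreducible p-prime i∣p
  ... | inj₁ i≡1  = i≡1
  ... | inj₂ refl = contradiction i∣d p∤d

  -- Any denominator prime to p is accepted, not only the reduced one, so sums and products inherit
  -- a witness without cancelling common factors.
  record Local (x : ℚ) : Set where
    constructor local
    field
      den   : ℕ
      num   : ℤ
      p∤den : ¬ p ∣ den
      den*x : ℕ→ℚ den * x ≡ ℤ→ℚ num

  p∤* : ∀ {a b} → ¬ p ∣ a → ¬ p ∣ b → ¬ p ∣ a ℕ.* b
  p∤* {a} {b} p∤a p∤b p∣ab = [ p∤a , p∤b ]′ (euclidsLemma a b p-prime p∣ab)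

  p∤1 : ¬ p ∣ 1
  p∤1 p∣1 with refl ← ∣1⇒≡1 p∣1 = ¬prime[1] p-prime

  Local-+ : ∀ {x y} → Local x → Local y → Local (x + y)
  Local-+ {x} {y} (local d m p∤d dx) (local e n p∤e ey) =
    local (d ℕ.* e) (ℤ.+ e ℤ.* m ℤ.+ ℤ.+ d ℤ.* n) (p∤* p∤d p∤e) (begin
      ℕ→ℚ (d ℕ.* e) * (x + y)
        ≡⟨ cong (_* (x + y)) (ℕ→ℚ-* d e) ⟩
      ℕ→ℚ d * ℕ→ℚ e * (x + y)
        ≡⟨ solve 4 (λ d e x y → d :* e :* (x :+ y) := e :* (d :* x) :+ d :* (e :* y)) refl (ℕ→ℚ d) (ℕ→ℚ e) x y ⟩
      ℕ→ℚ e * (ℕ→ℚ d * x) + ℕ→ℚ d * (ℕ→ℚ e * y)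
        ≡⟨ cong₂ (λ u v → ℕ→ℚ e * u + ℕ→ℚ d * v) dx ey ⟩
      ℕ→ℚ e * ℤ→ℚ m + ℕ→ℚ d * ℤ→ℚ n
        ≡⟨ cong₂ _+_ (ℤ→ℚ-* (ℤ.+ e) m) (ℤ→ℚ-* (ℤ.+ d) n) ⟨
      ℤ→ℚ (ℤ.+ e ℤ.* m) + ℤ→ℚ (ℤ.+ d ℤ.* n)
        ≡⟨ ℤ→ℚ-+ (ℤ.+ e ℤ.* m) (ℤ.+ d ℤ.* n) ⟨
      ℤ→ℚ (ℤ.+ e ℤ.* m ℤ.+ ℤ.+ d ℤ.* n) ∎)
    where open ≡-Reasoning

  Local-* : ∀ {x y} → Local x → Local y → Local (x * y)
  Local-* {x} {y} (local d m p∤d dx) (local e n p∤e ey) =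
    local (d ℕ.* e) (m ℤ.* n) (p∤* p∤d p∤e) (begin
      ℕ→ℚ (d ℕ.* e) * (x * y)
        ≡⟨ cong (_* (x * y)) (ℕ→ℚ-* d e) ⟩
      ℕ→ℚ d * ℕ→ℚ e * (x * y)
        ≡⟨ solve 4 (λ d e x y → d :* e :* (x :* y) := d :* x :* (e :* y)) refl (ℕ→ℚ d) (ℕ→ℚ e) x y ⟩
      ℕ→ℚ d * x * (ℕ→ℚ e * y)
        ≡⟨ cong₂ _*_ dx ey ⟩
      ℤ→ℚ m * ℤ→ℚ n
        ≡⟨ ℤ→ℚ-* m n ⟨
      ℤ→ℚ (m ℤ.* n) ∎)
    where open ≡-Reasoning

  Local-ℤ : ∀ z → Local (ℤ→ℚ z)
  Local-ℤ z = local 1 z p∤1 (ℚₚ.*-identityˡ (ℤ→ℚ z))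

  Local-ℕ : ∀ n → Local (ℕ→ℚ n)
  Local-ℕ n = Local-ℤ (ℤ.+ n)

  Local-inv : ∀ m → ¬ p ∣ suc m → Local (inv (suc m))
  Local-inv m p∤m = local (suc m) (ℤ.+ 1) p∤m (inv-inverse m)

  Local-neg : ∀ {x} → Local x → Local (- x)
  Local-neg {x} Lx = subst Local (trans (sym (ℚₚ.neg-distribˡ-* 1ℚ x)) (cong -_ (ℚₚ.*-identityˡ x)))
    (Local-* (Local-ℤ (ℤ.- ℤ.+ 1)) Lx)

  Local-- : ∀ {x y} → Local x → Local y → Local (x - y)
  Local-- Lx Ly = Local-+ Lx (Local-neg Ly)

  Local-↑ : ∀ {x} k → Local x → Local (x ↑ k)
  Local-↑ zero    Lx = Local-ℕ 1
  Local-↑ (suc k) Lx = Local-* Lx (Local-↑ k Lx)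

  Local-sumRange : ∀ c {f} → (∀ k → k < c → Local (f k)) → Local (sumRange 0 c f)
  Local-sumRange zero    Lf = Local-ℕ 0
  Local-sumRange (suc c) {f} Lf = subst Local (sym (sumRange-head c f))
    (Local-+ (Lf 0 (s≤s z≤n)) (Local-sumRange c (λ k k<c → Lf (suc k) (s≤s k<c))))

  -- Cross-multiplying gives ↥x · d = m · ↧x; as ↥x and ↧x are coprime, the reduced denominator
  -- divides `d`.
  Local⇒p∤↧ : ∀ {x} → Local x → ¬ p ∣ ↧ₙ x
  Local⇒p∤↧ {x} (local d m p∤d dx) p∣↧ = p∤d (∣-trans p∣↧ (coprime-divisor (coprime-↥↧ x) (divides ℤ.∣ m ∣ abs)))
    where
    open ≡-Reasoning
    ↥*d : ↥ x ℤ.* ℤ.+ d ≡ m ℤ.* ↧ x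
    ↥*d = ℤ→ℚ-injective (begin
      ℤ→ℚ (↥ x ℤ.* ℤ.+ d)        ≡⟨ ℤ→ℚ-* (↥ x) (ℤ.+ d) ⟩
      ℤ→ℚ (↥ x) * ℕ→ℚ d          ≡⟨ cong (_* ℕ→ℚ d) (↥≡↧* x) ⟩
      ℤ→ℚ (↧ x) * x * ℕ→ℚ d      ≡⟨ solve 3 (λ b x d → b :* x :* d := d :* x :* b) refl (ℤ→ℚ (↧ x)) x (ℕ→ℚ d) ⟩
      ℕ→ℚ d * x * ℤ→ℚ (↧ x)      ≡⟨ cong (_* ℤ→ℚ (↧ x)) dx ⟩
      ℤ→ℚ m * ℤ→ℚ (↧ x)          ≡⟨ ℤ→ℚ-* m (↧ x) ⟨
      ℤ→ℚ (m ℤ.* ↧ x)            ∎)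
    abs : ℤ.∣ ↥ x ∣ ℕ.* d ≡ ℤ.∣ m ∣ ℕ.* ↧ₙ x
    abs = trans (sym (ℤₚ.abs-* (↥ x) (ℤ.+ d))) (trans (cong ℤ.∣_∣ ↥*d) (ℤₚ.abs-* m (↧ x)))

  infix 4 _≋_
  -- Congruence modulo p times the local ring, with no locality demanded of `x` or `y` themselves.
  -- Locality can then be transported along it by `≋-Local`, which is how `Local-F` is obtained.
  record _≋_ (x y : ℚ) : Set where
    constructor cong-by
    field
      quot       : ℚ
      local-quot : Local quot
      x-y        : x - y ≡ ℕ→ℚ p * quot

  -- Clearing denominators gives d · ↥w = m · ↧w · p, and Euclid's lemma passes p on to ↥w because p
  -- does not divide `d`.
  p∣↥p*Local : ∀ {z} → Local z → p ∣ ℤ.∣ ↥ (ℕ→ℚ p * z) ∣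
  p∣↥p*Local {z} (local d m p∤d dz) = [ (λ p∣d → contradiction p∣d p∤d) , (λ e → e) ]′
    (euclidsLemma d ℤ.∣ ↥ w ∣ p-prime (divides ℤ.∣ m ℤ.* ↧ w ∣ abs))
    where
    open ≡-Reasoning
    w : ℚ
    w = ℕ→ℚ p * z
    d*↥ : ℤ.+ d ℤ.* ↥ w ≡ (m ℤ.* ↧ w) ℤ.* ℤ.+ p
    d*↥ = ℤ→ℚ-injective (begin
      ℤ→ℚ (ℤ.+ d ℤ.* ↥ w)             ≡⟨ ℤ→ℚ-* (ℤ.+ d) (↥ w) ⟩
      ℕ→ℚ d * ℤ→ℚ (↥ w)               ≡⟨ cong (ℕ→ℚ d *_) (↥≡↧* w) ⟩
      ℕ→ℚ d * (ℤ→ℚ (↧ w) * (ℕ→ℚ p * z))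
        ≡⟨ solve 4 (λ d b p z → d :* (b :* (p :* z)) := d :* z :* b :* p) refl (ℕ→ℚ d) (ℤ→ℚ (↧ w)) (ℕ→ℚ p) z ⟩
      ℕ→ℚ d * z * ℤ→ℚ (↧ w) * ℕ→ℚ p   ≡⟨ cong (λ u → u * ℤ→ℚ (↧ w) * ℕ→ℚ p) dz ⟩
      ℤ→ℚ m * ℤ→ℚ (↧ w) * ℕ→ℚ p       ≡⟨ cong (_* ℕ→ℚ p) (ℤ→ℚ-* m (↧ w)) ⟨
      ℤ→ℚ (m ℤ.* ↧ w) * ℕ→ℚ p         ≡⟨ ℤ→ℚ-* (m ℤ.* ↧ w) (ℤ.+ p) ⟨
      ℤ→ℚ (m ℤ.* ↧ w ℤ.* ℤ.+ p)       ∎)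
    abs : d ℕ.* ℤ.∣ ↥ w ∣ ≡ ℤ.∣ m ℤ.* ↧ w ∣ ℕ.* p
    abs = trans (sym (ℤₚ.abs-* (ℤ.+ d) (↥ w))) (trans (cong ℤ.∣_∣ d*↥) (ℤₚ.abs-* (m ℤ.* ↧ w) (ℤ.+ p)))

  ≋-Local : ∀ {x y} → x ≋ y → Local y → Local x
  ≋-Local {x} {y} (cong-by z Lz eq) Ly = subst Local
    (trans (cong (_+ y) (sym eq)) (solve 2 (λ x y → x :- y :+ y := x) refl x y))
    (Local-+ (Local-* (Local-ℕ p) Lz) Ly)

  ≋⇒modℚ : ∀ {x y} → x ≋ y → Local y → x ≡ y [modℚ p ]
  ≋⇒modℚ x≋y@(cong-by z Lz eq) Ly =
    ¬∣⇒coprime (Local⇒p∤↧ (≋-Local x≋y Ly)) , ¬∣⇒coprime (Local⇒p∤↧ Ly) ,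
    subst (λ w → p ∣ ℤ.∣ ↥ w ∣) (sym eq) (p∣↥p*Local Lz)

  ≡⇒≋ : ∀ {x y} → x ≡ y → x ≋ y
  ≡⇒≋ {x} refl = cong-by (0ℚ) (Local-ℕ 0) (trans (ℚₚ.+-inverseʳ x) (sym (ℚₚ.*-zeroʳ (ℕ→ℚ p))))

  ≋-sym : ∀ {x y} → x ≋ y → y ≋ x
  ≋-sym {x} {y} (cong-by z Lz eq) = cong-by (- z) (Local-neg Lz)
    (trans (solve 2 (λ x y → y :- x := :- (x :- y)) refl x y) (trans (cong -_ eq) (ℚₚ.neg-distribʳ-* (ℕ→ℚ p) z)))

  ≋-trans : ∀ {x y w} → x ≋ y → y ≋ w → x ≋ w
  ≋-trans {x} {y} {w} (cong-by z Lz eq) (cong-by z′ Lz′ eq′) = cong-by (z + z′) (Local-+ Lz Lz′)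
    (trans (solve 3 (λ x y w → x :- w := x :- y :+ (y :- w)) refl x y w)
      (trans (cong₂ _+_ eq eq′) (sym (ℚₚ.*-distribˡ-+ (ℕ→ℚ p) z z′))))

  ≋-+ : ∀ {x y x′ y′} → x ≋ y → x′ ≋ y′ → x + x′ ≋ y + y′
  ≋-+ {x} {y} {x′} {y′} (cong-by z Lz eq) (cong-by z′ Lz′ eq′) = cong-by (z + z′) (Local-+ Lz Lz′)
    (trans (solve 4 (λ x y x′ y′ → x :+ x′ :- (y :+ y′) := x :- y :+ (x′ :- y′)) refl x y x′ y′)
      (trans (cong₂ _+_ eq eq′) (sym (ℚₚ.*-distribˡ-+ (ℕ→ℚ p) z z′))))

  ≋-*ˡ : ∀ {w x y} → Local w → x ≋ y → w * x ≋ w * y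
  ≋-*ˡ {w} {x} {y} Lw (cong-by z Lz eq) = cong-by (w * z) (Local-* Lw Lz)
    (trans (solve 3 (λ w x y → w :* x :- w :* y := w :* (x :- y)) refl w x y)
      (trans (cong (w *_) eq) (solve 3 (λ w p z → w :* (p :* z) := p :* (w :* z)) refl w (ℕ→ℚ p) z)))

  ≋-*ʳ : ∀ {w x y} → Local w → x ≋ y → x * w ≋ y * w
  ≋-*ʳ {w} {x} {y} Lw x≋y = subst₂ _≋_ (ℚₚ.*-comm w x) (ℚₚ.*-comm w y) (≋-*ˡ Lw x≋y)

  ≋-neg : ∀ {x y} → x ≋ y → - x ≋ - y
  ≋-neg {x} {y} (cong-by z Lz eq) = cong-by (- z) (Local-neg Lz)
    (trans (solve 2 (λ x y → :- x :- (:- y) := :- (x :- y)) refl x y) (trans (cong -_ eq) (ℚₚ.neg-distribʳ-* (ℕ→ℚ p) z)))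

  ≋-cancel : ∀ m {x y} → ¬ p ∣ suc m → ℕ→ℚ (suc m) * x ≋ ℕ→ℚ (suc m) * y → x ≋ y
  ≋-cancel m {x} {y} p∤m eq = subst₂ _≋_ (inv-cancel m x) (inv-cancel m y) (≋-*ˡ (Local-inv m p∤m) eq)

  ≋-sumRange : ∀ c {f g} → (∀ k → k < c → f k ≋ g k) → sumRange 0 c f ≋ sumRange 0 c g
  ≋-sumRange zero    eq = ≡⇒≋ refl
  ≋-sumRange (suc c) {f} {g} eq = subst₂ _≋_ (sym (sumRange-head c f)) (sym (sumRange-head c g))
    (≋-+ (eq 0 (s≤s z≤n)) (≋-sumRange c (λ k k<c → eq (suc k) (s≤s k<c))))

-- Binomial coefficients

-- With n - k taken in ℚ instead of truncated, the ratio formula holds for every k: at k = n the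
-- factor is zero, and beyond that both binomials are. Both binomial congruences modulo p come from
-- this ratio.
binom-next : ∀ n k → ℕ→ℚ (suc k) * binom n (suc k) ≡ (ℕ→ℚ n - ℕ→ℚ k) * binom n k
binom-next zero    zero    = refl
binom-next zero    (suc k) = trans (ℚₚ.*-zeroʳ (ℕ→ℚ (suc (suc k)))) (sym (ℚₚ.*-zeroʳ (ℕ→ℚ 0 - ℕ→ℚ (suc k))))
binom-next (suc n) zero    = begin
  1ℚ * binom (suc n) 1               ≡⟨ cong (1ℚ *_) (binom-suc n 0) ⟩
  1ℚ * (1ℚ + binom n 1)              ≡⟨ solve 1 (λ b → con 1ℚ :* (con 1ℚ :+ b) := con 1ℚ :+ con 1ℚ :* b) refl (binom n 1) ⟩
  1ℚ + 1ℚ * binom n 1                ≡⟨ cong (1ℚ +_) (binom-next n 0) ⟩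
  1ℚ + (ℕ→ℚ n - 0ℚ) * 1ℚ             ≡⟨ solve 1 (λ n → con 1ℚ :+ (n :- con 0ℚ) :* con 1ℚ := (con 1ℚ :+ n :- con 0ℚ) :* con 1ℚ) refl (ℕ→ℚ n) ⟩
  (1ℚ + ℕ→ℚ n - 0ℚ) * 1ℚ             ≡⟨ cong (λ m → (m - 0ℚ) * 1ℚ) (ℕ→ℚ-suc n) ⟨
  (ℕ→ℚ (suc n) - 0ℚ) * 1ℚ            ∎
  where open ≡-Reasoning
binom-next (suc n) (suc k) = begin
  K₂ * binom (suc n) (suc (suc k))
    ≡⟨ cong₂ _*_ (ℕ→ℚ-suc (suc k)) (binom-suc n (suc k)) ⟩
  (1ℚ + K₁) * (b₁ + b₂)
    ≡⟨ solve 3 (λ K b₁ b₂ → (con 1ℚ :+ K) :* (b₁ :+ b₂) := (con 1ℚ :+ K) :* b₁ :+ (con 1ℚ :+ K) :* b₂) refl K₁ b₁ b₂ ⟩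
  (1ℚ + K₁) * b₁ + (1ℚ + K₁) * b₂
    ≡⟨ cong (λ z → (1ℚ + K₁) * b₁ + z * b₂) (sym (ℕ→ℚ-suc (suc k))) ⟩
  (1ℚ + K₁) * b₁ + K₂ * b₂
    ≡⟨ cong ((1ℚ + K₁) * b₁ +_) (binom-next n (suc k)) ⟩
  (1ℚ + K₁) * b₁ + (N - K₁) * b₁
    ≡⟨ cong (λ z → (1ℚ + z) * b₁ + (N - z) * b₁) (ℕ→ℚ-suc k) ⟩
  (1ℚ + (1ℚ + K)) * b₁ + (N - (1ℚ + K)) * b₁
    ≡⟨ solve 3 (λ K N b → (con 1ℚ :+ (con 1ℚ :+ K)) :* b :+ (N :- (con 1ℚ :+ K)) :* b := (con 1ℚ :+ K) :* b :+ (N :- K) :* b) refl K N b₁ ⟩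
  (1ℚ + K) * b₁ + (N - K) * b₁
    ≡⟨ cong (λ z → z * b₁ + (N - K) * b₁) (sym (ℕ→ℚ-suc k)) ⟩
  K₁ * b₁ + (N - K) * b₁
    ≡⟨ cong (_+ (N - K) * b₁) (binom-next n k) ⟩
  (N - K) * b₀ + (N - K) * b₁
    ≡⟨ solve 4 (λ N K a b → (N :- K) :* a :+ (N :- K) :* b := (con 1ℚ :+ N :- (con 1ℚ :+ K)) :* (a :+ b)) refl N K b₀ b₁ ⟩
  (1ℚ + N - (1ℚ + K)) * (b₀ + b₁)
    ≡⟨ cong₂ _*_ (cong₂ _-_ (ℕ→ℚ-suc n) (ℕ→ℚ-suc k)) (binom-suc n k) ⟨
  (ℕ→ℚ (suc n) - K₁) * binom (suc n) (suc k) ∎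
  where
  open ≡-Reasoning
  N K K₁ K₂ b₀ b₁ b₂ : ℚ
  N = ℕ→ℚ n
  K = ℕ→ℚ k
  K₁ = ℕ→ℚ (suc k)
  K₂ = ℕ→ℚ (suc (suc k))
  b₀ = binom n k
  b₁ = binom n (suc k)
  b₂ = binom n (suc (suc k))

binom-absorb : ∀ n k → ℕ→ℚ (suc k) * binom (suc n) (suc k) ≡ ℕ→ℚ (suc n) * binom n k
binom-absorb n k = begin
  ℕ→ℚ (suc k) * binom (suc n) (suc k)
    ≡⟨ cong (ℕ→ℚ (suc k) *_) (binom-suc n k) ⟩
  ℕ→ℚ (suc k) * (binom n k + binom n (suc k))
    ≡⟨ ℚₚ.*-distribˡ-+ (ℕ→ℚ (suc k)) (binom n k) (binom n (suc k)) ⟩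
  ℕ→ℚ (suc k) * binom n k + ℕ→ℚ (suc k) * binom n (suc k)
    ≡⟨ cong₂ (λ u v → u * binom n k + v) (ℕ→ℚ-suc k) (binom-next n k) ⟩
  (1ℚ + ℕ→ℚ k) * binom n k + (ℕ→ℚ n - ℕ→ℚ k) * binom n k
    ≡⟨ solve 3 (λ k n b → (con 1ℚ :+ k) :* b :+ (n :- k) :* b := (con 1ℚ :+ n) :* b) refl (ℕ→ℚ k) (ℕ→ℚ n) (binom n k) ⟩
  (1ℚ + ℕ→ℚ n) * binom n k
    ≡⟨ cong (_* binom n k) (ℕ→ℚ-suc n) ⟨
  ℕ→ℚ (suc n) * binom n k ∎
  where open ≡-Reasoning

ℕ→ℚ-1+2* : ∀ k → ℕ→ℚ (suc (2 ℕ.* k)) ≡ 1ℚ + ℕ→ℚ 2 * ℕ→ℚ k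
ℕ→ℚ-1+2* k = trans (ℕ→ℚ-suc (2 ℕ.* k)) (cong (1ℚ +_) (ℕ→ℚ-* 2 k))

binom-central : ∀ k → ℕ→ℚ (suc k) * binom (2 ℕ.* suc k) (suc k) ≡ ℕ→ℚ 2 * ℕ→ℚ (suc (2 ℕ.* k)) * binom (2 ℕ.* k) k
binom-central k = begin
  K₁ * binom (2 ℕ.* suc k) (suc k)
    ≡⟨ cong (λ m → K₁ * binom m (suc k)) (2*-suc k) ⟩
  K₁ * binom (suc (suc (2 ℕ.* k))) (suc k)
    ≡⟨ binom-absorb (suc (2 ℕ.* k)) k ⟩
  ℕ→ℚ (suc (suc (2 ℕ.* k))) * b
    ≡⟨ cong (λ m → ℕ→ℚ m * b) (sym (2*-suc k)) ⟩
  ℕ→ℚ (2 ℕ.* suc k) * b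
    ≡⟨ cong (_* b) (ℕ→ℚ-* 2 (suc k)) ⟩
  ℕ→ℚ 2 * K₁ * b
    ≡⟨ ℚₚ.*-assoc (ℕ→ℚ 2) K₁ b ⟩
  ℕ→ℚ 2 * (K₁ * b)
    -- Reading k + 1 as (2k + 1) - k turns C(2k+1, k) into C(2k+1, k+1), to which absorption applies
    -- a second time.
    ≡⟨ cong (λ z → ℕ→ℚ 2 * (z * b)) [2k+1]-k ⟨
  ℕ→ℚ 2 * ((ℕ→ℚ (suc (2 ℕ.* k)) - ℕ→ℚ k) * b)
    ≡⟨ cong (ℕ→ℚ 2 *_) (binom-next (suc (2 ℕ.* k)) k) ⟨
  ℕ→ℚ 2 * (K₁ * binom (suc (2 ℕ.* k)) (suc k))
    ≡⟨ cong (ℕ→ℚ 2 *_) (binom-absorb (2 ℕ.* k) k) ⟩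
  ℕ→ℚ 2 * (ℕ→ℚ (suc (2 ℕ.* k)) * binom (2 ℕ.* k) k)
    ≡⟨ ℚₚ.*-assoc (ℕ→ℚ 2) (ℕ→ℚ (suc (2 ℕ.* k))) (binom (2 ℕ.* k) k) ⟨
  ℕ→ℚ 2 * ℕ→ℚ (suc (2 ℕ.* k)) * binom (2 ℕ.* k) k ∎
  where
  open ≡-Reasoning
  K₁ b : ℚ
  K₁ = ℕ→ℚ (suc k)
  b = binom (suc (2 ℕ.* k)) k
  [2k+1]-k : ℕ→ℚ (suc (2 ℕ.* k)) - ℕ→ℚ k ≡ K₁
  [2k+1]-k = trans (cong (_- ℕ→ℚ k) (ℕ→ℚ-1+2* k))
    (trans (solve 1 (λ k → con 1ℚ :+ con (ℕ→ℚ 2) :* k :- k := con 1ℚ :+ k) refl (ℕ→ℚ k)) (sym (ℕ→ℚ-suc k)))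

-- Special values of powers, inverses and the sequences above

2ℚ -1ℚ -2ℚ -3ℚ -4ℚ -⅓ : ℚ
2ℚ = ℕ→ℚ 2
-1ℚ = - 1ℚ
-2ℚ = - 2ℚ
-3ℚ = - ℕ→ℚ 3
-4ℚ = - ℕ→ℚ 4
-⅓ = - inv 3

1↑ : ∀ n → 1ℚ ↑ n ≡ 1ℚ
1↑ zero    = refl
1↑ (suc n) = trans (ℚₚ.*-identityˡ (1ℚ ↑ n)) (1↑ n)

↑-2* : ∀ x k → x ↑ (2 ℕ.* k) ≡ (x * x) ↑ k
↑-2* x k = trans (sym (↑-assoc x 2 k)) (cong (λ z → (x * z) ↑ k) (ℚₚ.*-identityʳ x))

inv-unique : ∀ m {x} → ℕ→ℚ m * x ≡ 1ℚ → x ≡ inv m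
inv-unique zero    {x} eq = contradiction (trans (sym (ℚₚ.*-zeroˡ x)) eq) λ ()
inv-unique (suc m) {x} eq = trans (sym (inv-cancel m x)) (trans (cong (inv (suc m) *_) eq) (ℚₚ.*-identityʳ (inv (suc m))))

inv-2* : ∀ k → inv (suc (suc (2 ℕ.* k))) ≡ ½ * inv (suc k)
inv-2* k = sym (inv-unique (suc (suc (2 ℕ.* k))) (begin
  ℕ→ℚ (suc (suc (2 ℕ.* k))) * (½ * inv (suc k))
    ≡⟨ cong (λ m → ℕ→ℚ m * (½ * inv (suc k))) (sym (2*-suc k)) ⟩
  ℕ→ℚ (2 ℕ.* suc k) * (½ * inv (suc k))
    ≡⟨ cong (_* (½ * inv (suc k))) (ℕ→ℚ-* 2 (suc k)) ⟩
  ℕ→ℚ 2 * ℕ→ℚ (suc k) * (½ * inv (suc k))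
    ≡⟨ solve 2 (λ K i → con (ℕ→ℚ 2) :* K :* (con ½ :* i) := K :* i) refl (ℕ→ℚ (suc k)) (inv (suc k)) ⟩
  ℕ→ℚ (suc k) * inv (suc k)
    ≡⟨ inv-inverse k ⟩
  1ℚ ∎))
  where open ≡-Reasoning

α-even : ∀ D k → α D (2 ℕ.* k) ≡ D ↑ k
α-even D zero    = refl
α-even D (suc k) = trans (cong (α D) (2*-suc k)) (cong (D *_) (α-even D k))

α-odd : ∀ D k → α D (suc (2 ℕ.* k)) ≡ 0ℚ
α-odd D zero    = refl
α-odd D (suc k) = trans (cong (α D ∘ suc) (2*-suc k)) (trans (cong (D *_) (α-odd D k)) (ℚₚ.*-zeroʳ D))

Hₓ-sumRange : ∀ y n → Hₓ y n ≡ sumRange 0 n (λ j → inv (suc j) * (1ℚ - y ↑ suc j))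
Hₓ-sumRange y zero    = refl
Hₓ-sumRange y (suc n) = trans (cong (_+ inv (suc n) * (1ℚ - y ↑ suc n)) (Hₓ-sumRange y n))
  (sym (sumRange-snoc 0 n (λ j → inv (suc j) * (1ℚ - y ↑ suc j))))

-- The factor 1 - (-1)^j is 2 for odd j and 0 for even j, so the left side is twice the sum of the
-- odd reciprocals up to 2k, and the even ones add up to half of `H k`.
Hₓ-1-even : ∀ k → Hₓ -1ℚ (2 ℕ.* k) ≡ ℕ→ℚ 2 * H (2 ℕ.* k) - H k
Hₓ-1-even zero    = refl
Hₓ-1-even (suc k) = begin
  Hₓ -1ℚ (2 ℕ.* suc k)
    ≡⟨ cong (Hₓ -1ℚ) (2*-suc k) ⟩
  Hₓ -1ℚ (2 ℕ.* k) + i₁ * (1ℚ - -1ℚ * -1ℚ ↑ (2 ℕ.* k)) + i₂ * (1ℚ - -1ℚ * (-1ℚ * -1ℚ ↑ (2 ℕ.* k)))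
    ≡⟨ cong₂ (λ h s → h + i₁ * (1ℚ - -1ℚ * s) + i₂ * (1ℚ - -1ℚ * (-1ℚ * s))) (Hₓ-1-even k) (trans (↑-2* -1ℚ k) (1↑ k)) ⟩
  ℕ→ℚ 2 * h - H k + i₁ * (1ℚ - -1ℚ * 1ℚ) + i₂ * (1ℚ - -1ℚ * (-1ℚ * 1ℚ))
    ≡⟨ cong (λ i → ℕ→ℚ 2 * h - H k + i₁ * (1ℚ - -1ℚ * 1ℚ) + i * (1ℚ - -1ℚ * (-1ℚ * 1ℚ))) (inv-2* k) ⟩
  ℕ→ℚ 2 * h - H k + i₁ * (1ℚ - -1ℚ * 1ℚ) + ½ * i * (1ℚ - -1ℚ * (-1ℚ * 1ℚ))
    ≡⟨ solve 4 (λ h h′ i₁ i → con (ℕ→ℚ 2) :* h :- h′ :+ i₁ :* con (1ℚ - -1ℚ * 1ℚ) :+ con ½ :* i :* con (1ℚ - -1ℚ * (-1ℚ * 1ℚ))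
          := con (ℕ→ℚ 2) :* (h :+ i₁ :+ con ½ :* i) :- (h′ :+ i)) refl h (H k) i₁ i ⟩
  ℕ→ℚ 2 * (h + i₁ + ½ * i) - (H k + i)
    ≡⟨ cong (λ i′ → ℕ→ℚ 2 * (h + i₁ + i′) - (H k + i)) (inv-2* k) ⟨
  ℕ→ℚ 2 * H (suc (suc (2 ℕ.* k))) - H (suc k)
    ≡⟨ cong (λ m → ℕ→ℚ 2 * H m - H (suc k)) (2*-suc k) ⟨
  ℕ→ℚ 2 * H (2 ℕ.* suc k) - H (suc k) ∎
  where
  open ≡-Reasoning
  h i i₁ i₂ : ℚ
  h = H (2 ℕ.* k)
  i = inv (suc k)
  i₁ = inv (suc (2 ℕ.* k))
  i₂ = inv (suc (suc (2 ℕ.* k)))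

↑-inverse : ∀ {x y} → x * y ≡ 1ℚ → ∀ k → x ↑ k * y ↑ k ≡ 1ℚ
↑-inverse {x} {y} eq k = trans (sym (↑-distrib x y k)) (trans (cong (_↑ k) eq) (1↑ k))

inv-4^ : ∀ k → inv (4 ℕ.^ k) ≡ inv 4 ↑ k
inv-4^ k = sym (inv-unique (4 ℕ.^ k) (trans (cong (_* inv 4 ↑ k) (ℕ→ℚ-^ 4 k)) (↑-inverse refl k)))

-- At D = 1 both coefficient sequences add up half of the binomial coefficients of a row. This needs
-- a positive exponent, as the row of exponent 0 has only its even entry.
E-1 : ∀ m → E 1ℚ (suc m) ≡ ℕ→ℚ 2 ↑ m
E-1 zero    = refl
E-1 (suc m) = begin
  E 1ℚ (suc (suc m))                        ≡⟨ E-suc 1ℚ (suc m) ⟩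
  E 1ℚ (suc m) + 1ℚ * (O 1ℚ m + E 1ℚ m)     ≡⟨ cong (λ z → E 1ℚ (suc m) + z) O≡E ⟩
  E 1ℚ (suc m) + E 1ℚ (suc m)               ≡⟨ solve 1 (λ e → e :+ e := con (ℕ→ℚ 2) :* e) refl (E 1ℚ (suc m)) ⟩
  ℕ→ℚ 2 * E 1ℚ (suc m)                      ≡⟨ cong (ℕ→ℚ 2 *_) (E-1 m) ⟩
  ℕ→ℚ 2 ↑ suc m                             ∎
  where
  open ≡-Reasoning
  O≡E : 1ℚ * (O 1ℚ m + E 1ℚ m) ≡ E 1ℚ (suc m)
  O≡E = trans (solve 2 (λ o e → con 1ℚ :* (o :+ e) := e :+ con 1ℚ :* o) refl (O 1ℚ m) (E 1ℚ m)) (sym (E-suc 1ℚ m))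

p*fermatQuotient : ∀ m a → ℕ→ℚ (suc m) * fermatQuotient (suc m) a ≡ ℕ→ℚ a ↑ m - 1ℚ
p*fermatQuotient m a = trans (/-ℤ→ℚ (ℤ.+ (a ℕ.^ m) ℤ.- ℤ.+ 1) m)
  (trans (ℤ→ℚ-+ (ℤ.+ (a ℕ.^ m)) (ℤ.- ℤ.+ 1)) (cong (_- 1ℚ) (ℕ→ℚ-^ a m)))

sgn-↑ : ∀ n → sgn n ≡ -1ℚ ↑ n
sgn-↑ zero    = refl
sgn-↑ (suc n) = trans (cong -_ (sgn-↑ n)) (solve 1 (λ x → :- x := con -1ℚ :* x) refl (-1ℚ ↑ n))

-- Congruences modulo p = 2n + 1

module OddPrime {n : ℕ} (p-prime : Prime (suc (2 ℕ.* n))) (1<n : 1 < n) where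
  open Localization p-prime

  p : ℕ
  p = suc (2 ℕ.* n)

  p∤small : ∀ {k} → k < 2 ℕ.* n → ¬ p ∣ suc k
  p∤small k<2n p∣k = ℕₚ.<⇒≱ (s≤s k<2n) (∣⇒≤ p∣k)

  n≤2n : n ≤ 2 ℕ.* n
  n≤2n = ℕₚ.m≤m+n n (n ℕ.+ 0)

  Local-½ : Local ½
  Local-½ = Local-inv 1 (p∤small (ℕₚ.<-≤-trans 1<n n≤2n))

  Local-H : ∀ k → k ≤ 2 ℕ.* n → Local (H k)
  Local-H zero    _    = Local-ℕ 0
  Local-H (suc k) k<2n = Local-+ (Local-H k (ℕₚ.<⇒≤ k<2n)) (Local-inv k (p∤small k<2n))

  -- C(2k, k) = (-4)^k C(-1/2, k), and n is -1/2 modulo p. The bound on k keeps every divisor k + 1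
  -- of the induction prime to p.
  central-binom-≋ : ∀ k → k ≤ n → binom (2 ℕ.* k) k ≋ -4ℚ ↑ k * binom n k
  central-binom-≋ zero    _   = ≡⇒≋ refl
  central-binom-≋ (suc k) k<n = ≋-cancel k (p∤small (ℕₚ.<-≤-trans k<n n≤2n))
    (≋-trans (≡⇒≋ (binom-central k))
    (≋-trans (≋-*ˡ (Local-* (Local-ℕ 2) (Local-ℕ (suc (2 ℕ.* k)))) (central-binom-≋ k (ℕₚ.<⇒≤ k<n)))
      -- In 2 (1 + 2k) + 4 (n - k) the terms in k cancel, leaving 2 (1 + 2n) = 2p.
      (cong-by (ℕ→ℚ 2 * (X * b)) (Local-* (Local-ℕ 2) (Local-* (Local-↑ k (Local-ℤ (ℤ.- ℤ.+ 4))) (Local-ℕ (n C k)))) (begin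
        ℕ→ℚ 2 * M * (X * b) - K₁ * (-4ℚ * X * b′)
          ≡⟨ solve 5 (λ M X b K b′ → con (ℕ→ℚ 2) :* M :* (X :* b) :- K :* (con -4ℚ :* X :* b′)
                := con (ℕ→ℚ 2) :* M :* (X :* b) :- con -4ℚ :* X :* (K :* b′)) refl M X b K₁ b′ ⟩
        ℕ→ℚ 2 * M * (X * b) - -4ℚ * X * (K₁ * b′)
          ≡⟨ cong₂ (λ u v → ℕ→ℚ 2 * u * (X * b) - -4ℚ * X * v) (ℕ→ℚ-1+2* k) (binom-next n k) ⟩
        ℕ→ℚ 2 * (1ℚ + ℕ→ℚ 2 * K) * (X * b) - -4ℚ * X * ((N - K) * b)
          ≡⟨ solve 4 (λ K X b N → con (ℕ→ℚ 2) :* (con 1ℚ :+ con (ℕ→ℚ 2) :* K) :* (X :* b) :- con -4ℚ :* X :* ((N :- K) :* b)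
                := (con 1ℚ :+ con (ℕ→ℚ 2) :* N) :* (con (ℕ→ℚ 2) :* (X :* b))) refl K X b N ⟩
        (1ℚ + ℕ→ℚ 2 * N) * (ℕ→ℚ 2 * (X * b))
          ≡⟨ cong (_* (ℕ→ℚ 2 * (X * b))) (ℕ→ℚ-1+2* n) ⟨
        ℕ→ℚ p * (ℕ→ℚ 2 * (X * b)) ∎))))
    where
    open ≡-Reasoning
    M X b b′ K K₁ N : ℚ
    M = ℕ→ℚ (suc (2 ℕ.* k))
    X = -4ℚ ↑ k
    b = binom n k
    b′ = binom n (suc k)
    K = ℕ→ℚ k
    K₁ = ℕ→ℚ (suc k)
    N = ℕ→ℚ n

  -- The upper index p - 1 is -1 modulo p, and C(-1, k) = (-1)^k; the error at each step is (2n - k)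
  -- + (1 + k) = p times a power of -1.
  alternating-binom-≋ : ∀ k → k ≤ 2 ℕ.* n → binom (2 ℕ.* n) k ≋ -1ℚ ↑ k
  alternating-binom-≋ zero    _    = ≡⇒≋ refl
  alternating-binom-≋ (suc k) k<2n = ≋-cancel k (p∤small k<2n)
    (≋-trans (≡⇒≋ (binom-next (2 ℕ.* n) k))
    (≋-trans (≋-*ˡ (Local-- (Local-ℕ (2 ℕ.* n)) (Local-ℕ k)) (alternating-binom-≋ k (ℕₚ.<⇒≤ k<2n)))
      (cong-by X (Local-↑ k (Local-ℤ (ℤ.- ℤ.+ 1))) (begin
        (N - K) * X - ℕ→ℚ (suc k) * (-1ℚ * X)
          ≡⟨ cong (λ z → (N - K) * X - z * (-1ℚ * X)) (ℕ→ℚ-suc k) ⟩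
        (N - K) * X - (1ℚ + K) * (-1ℚ * X)
          ≡⟨ solve 3 (λ N K X → (N :- K) :* X :- (con 1ℚ :+ K) :* (con -1ℚ :* X) := (con 1ℚ :+ N) :* X) refl N K X ⟩
        (1ℚ + N) * X
          ≡⟨ cong (_* X) (ℕ→ℚ-suc (2 ℕ.* n)) ⟨
        ℕ→ℚ p * X ∎))))
    where
    open ≡-Reasoning
    X K N : ℚ
    X = -1ℚ ↑ k
    K = ℕ→ℚ k
    N = ℕ→ℚ (2 ℕ.* n)

  -- Since C(p, k)/p = C(p-1, k-1)/k, this form of (E(D) - 1)/p contains no overall division by p,
  -- and its coefficients can be reduced one by one.
  F : ℚ → ℚ
  F D = B (2 ℕ.* n) (λ k → inv (suc k) * α D (suc k))

  p*F : ∀ D → ℕ→ℚ p * F D ≡ E D p - 1ℚ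
  p*F D = begin
    ℕ→ℚ p * F D
      ≡⟨ B-absorb (2 ℕ.* n) (λ k → inv k * α D k) ⟨
    B p (λ k → ℕ→ℚ k * (inv k * α D k))
      ≡⟨ B-cong p k*inv ⟩
    -- `0ℚ ↑ k` is 1 at k = 0 and 0 elsewhere; it accounts for the constant term of E(D), which
    -- `inv 0 = 0` has removed.
    B p (λ k → α D k - 0ℚ ↑ k)
      ≡⟨ B-- p (α D) (0ℚ ↑_) ⟩
    E D p - B p (0ℚ ↑_)
      ≡⟨ cong (λ z → E D p - z) (trans (B-↑ p 0ℚ) (1↑ p)) ⟩
    E D p - 1ℚ ∎
    where
    open ≡-Reasoning
    k*inv : ∀ k → ℕ→ℚ k * (inv k * α D k) ≡ α D k - 0ℚ ↑ k
    k*inv zero    = refl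
    k*inv (suc k) = trans (sym (ℚₚ.*-assoc (ℕ→ℚ (suc k)) (inv (suc k)) (α D (suc k))))
      (trans (cong (_* α D (suc k)) (inv-inverse k))
        (solve 2 (λ a z → con 1ℚ :* a := a :- con 0ℚ :* z) refl (α D (suc k)) (0ℚ ↑ k)))

  -- The truncated series of log(1 - D)/2. It is what remains of `F` modulo p: only the terms with k
  -- + 1 = 2j survive, each with sign -1 and with 1/(2j) in front of D^j.
  G : ℚ → ℕ → ℚ
  G D c = sumRange 0 c (λ j → - ½ * (inv (suc j) * D ↑ suc j))

  Local-α : ∀ {D} k → Local D → Local (α D k)
  Local-α zero          LD = Local-ℕ 1
  Local-α (suc zero)    LD = Local-ℕ 0
  Local-α (suc (suc k)) LD = Local-* LD (Local-α k LD)

  F≋G : ∀ {D} → Local D → F D ≋ G D n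
  F≋G {D} LD = ≋-trans (≡⇒≋ (begin
      F D
        ≡⟨ B-sumRange (2 ℕ.* n) p f ℕₚ.≤-refl ⟨
      sumRange 0 p (λ k → binom (2 ℕ.* n) k * f k)
        ≡⟨ sumRange-snoc 0 (2 ℕ.* n) (λ k → binom (2 ℕ.* n) k * f k) ⟩
      sumRange 0 (2 ℕ.* n) (λ k → binom (2 ℕ.* n) k * f k) + binom (2 ℕ.* n) (2 ℕ.* n) * (inv p * α D p)
        -- The last term is the only one with denominator p; it vanishes because p is odd, so √D ^ p
        -- has no rational part.
        ≡⟨ cong (λ a → sumRange 0 (2 ℕ.* n) (λ k → binom (2 ℕ.* n) k * f k) + binom (2 ℕ.* n) (2 ℕ.* n) * (inv p * a)) (α-odd D n) ⟩
      sumRange 0 (2 ℕ.* n) (λ k → binom (2 ℕ.* n) k * f k) + binom (2 ℕ.* n) (2 ℕ.* n) * (inv p * 0ℚ)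
        ≡⟨ solve 3 (λ s b i → s :+ b :* (i :* con 0ℚ) := s) refl
             (sumRange 0 (2 ℕ.* n) (λ k → binom (2 ℕ.* n) k * f k)) (binom (2 ℕ.* n) (2 ℕ.* n)) (inv p) ⟩
      sumRange 0 (2 ℕ.* n) (λ k → binom (2 ℕ.* n) k * f k) ∎))
    (≋-trans (≋-sumRange (2 ℕ.* n) (λ k k<2n →
        ≋-*ʳ (Local-* (Local-inv k (p∤small k<2n)) (Local-α (suc k) LD)) (alternating-binom-≋ k (ℕₚ.<⇒≤ k<2n))))
      (≡⇒≋ (trans (sumRange-pairs n (λ k → -1ℚ ↑ k * f k)) (sumRange-cong 0 n pair))))
    where
    open ≡-Reasoning
    f : ℕ → ℚ
    f k = inv (suc k) * α D (suc k)
    pair : ∀ j → -1ℚ ↑ (2 ℕ.* j) * f (2 ℕ.* j) + -1ℚ * -1ℚ ↑ (2 ℕ.* j) * f (suc (2 ℕ.* j)) ≡ - ½ * (inv (suc j) * D ↑ suc j)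
    pair j = begin
      s * (i₁ * α D (suc (2 ℕ.* j))) + -1ℚ * s * (i₂ * (D * α D (2 ℕ.* j)))
        ≡⟨ cong₂ (λ a s′ → s * (i₁ * a) + -1ℚ * s′ * (i₂ * (D * α D (2 ℕ.* j)))) (α-odd D j) (trans (↑-2* -1ℚ j) (1↑ j)) ⟩
      s * (i₁ * 0ℚ) + -1ℚ * 1ℚ * (i₂ * (D * α D (2 ℕ.* j)))
        ≡⟨ cong₂ (λ i a → s * (i₁ * 0ℚ) + -1ℚ * 1ℚ * (i * (D * a))) (inv-2* j) (α-even D j) ⟩
      s * (i₁ * 0ℚ) + -1ℚ * 1ℚ * (½ * inv (suc j) * (D * D ↑ j))
        ≡⟨ solve 4 (λ s i₁ i d → s :* (i₁ :* con 0ℚ) :+ con (-1ℚ * 1ℚ) :* (con ½ :* i :* d) := con (- ½) :* (i :* d)) refl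
             s i₁ (inv (suc j)) (D * D ↑ j) ⟩
      - ½ * (inv (suc j) * D ↑ suc j) ∎
      where
      s i₁ i₂ : ℚ
      s = -1ℚ ↑ (2 ℕ.* j)
      i₁ = inv (suc (2 ℕ.* j))
      i₂ = inv (suc (suc (2 ℕ.* j)))

  Hₓ-G : ∀ D c → Hₓ D c ≡ ℕ→ℚ 2 * (G D c - G 1ℚ c)
  Hₓ-G D zero    = refl
  Hₓ-G D (suc c) = begin
    Hₓ D c + i * (1ℚ - d)
      ≡⟨ cong (_+ i * (1ℚ - d)) (Hₓ-G D c) ⟩
    ℕ→ℚ 2 * (G D c - G 1ℚ c) + i * (1ℚ - d)
      ≡⟨ solve 4 (λ g g₁ i d → con (ℕ→ℚ 2) :* (g :- g₁) :+ i :* (con 1ℚ :- d)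
             := con (ℕ→ℚ 2) :* (g :+ con (- ½) :* (i :* d) :- (g₁ :+ con (- ½) :* (i :* con 1ℚ)))) refl (G D c) (G 1ℚ c) i d ⟩
    ℕ→ℚ 2 * (G D c + - ½ * (i * d) - (G 1ℚ c + - ½ * (i * 1ℚ)))
      ≡⟨ cong (λ o → ℕ→ℚ 2 * (G D c + - ½ * (i * d) - (G 1ℚ c + - ½ * (i * o)))) (1↑ (suc c)) ⟨
    ℕ→ℚ 2 * (G D c + - ½ * (i * d) - (G 1ℚ c + - ½ * (i * 1ℚ ↑ suc c)))
      ≡⟨ cong₂ (λ u v → ℕ→ℚ 2 * (u - v)) (sumRange-snoc 0 c (λ j → - ½ * (inv (suc j) * D ↑ suc j)))
           (sumRange-snoc 0 c (λ j → - ½ * (inv (suc j) * 1ℚ ↑ suc j))) ⟨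
    ℕ→ℚ 2 * (G D (suc c) - G 1ℚ (suc c)) ∎
    where
    open ≡-Reasoning
    i d : ℚ
    i = inv (suc c)
    d = D ↑ suc c

  -- The denominators in `G D n` are 2 and the integers up to n, so locality is evident there and is
  -- carried over to `F D` by the congruence.
  Local-F : ∀ {D} → Local D → Local (F D)
  Local-F {D} LD = ≋-Local (F≋G LD) (Local-sumRange n (λ j j<n →
    Local-* (Local-neg Local-½) (Local-* (Local-inv j (p∤small (ℕₚ.<-≤-trans j<n n≤2n))) (Local-↑ (suc j) LD))))

  Hₓ≋F : ∀ {D} → Local D → Hₓ D n ≋ ℕ→ℚ 2 * (F D - F 1ℚ)
  Hₓ≋F {D} LD = ≋-trans (≡⇒≋ (Hₓ-G D n))
    (≋-*ˡ (Local-ℕ 2) (≋-+ (≋-sym (F≋G LD)) (≋-neg (≋-sym (F≋G (Local-ℕ 1))))))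

  Local-⅓ : Local -⅓
  Local-⅓ = Local-neg (Local-inv 2 (p∤small (ℕₚ.≤-trans (ℕₚ.n≤1+n 3) (ℕₚ.*-monoʳ-≤ 2 1<n))))

  -- The two sums in terms of Hₓ at -1/3 and -3

  sum-binom-H : sumRange 0 (suc n) (λ k → binom (2 ℕ.* k) k * H k) ≋ -3ℚ ↑ n * Hₓ -⅓ n
  sum-binom-H = ≋-trans (≋-sumRange (suc n) λ { k (s≤s k≤n) →
      ≋-*ʳ (Local-H k (ℕₚ.≤-trans k≤n n≤2n)) (central-binom-≋ k k≤n) })
    (≡⇒≋ (begin
      sumRange 0 (suc n) (λ k → -4ℚ ↑ k * binom n k * H k)
        ≡⟨ sumRange-cong 0 (suc n) (λ k → trans (cong (-4ℚ ↑ k * binom n k *_) (sym (Hₓ-0 k)))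
             (solve 3 (λ x b h → x :* b :* h := b :* (x :* h)) refl (-4ℚ ↑ k) (binom n k) (Hₓ 0ℚ k))) ⟩
      sumRange 0 (suc n) (λ k → binom n k * (-4ℚ ↑ k * Hₓ 0ℚ k))
        ≡⟨ B-sumRange n (suc n) (λ k → -4ℚ ↑ k * Hₓ 0ℚ k) ℕₚ.≤-refl ⟩
      B n (λ k → -4ℚ ↑ k * Hₓ 0ℚ k)
        ≡⟨ B-Hₓ -4ℚ 0ℚ -⅓ refl n ⟩
      -3ℚ ↑ n * Hₓ -⅓ n ∎))
    where open ≡-Reasoning

  term : ℕ → ℚ
  term k = inv (4 ℕ.^ k) * binom (4 ℕ.* k) (2 ℕ.* k) * (ℕ→ℚ 2 * H (2 ℕ.* k) - H k)

  -- Modulo p, 4^(-k) C(4k, 2k) becomes 4^k C(n, 2k) = (±2)^(2k) C(n, 2k), so only even indices of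
  -- row n occur. Adding the transforms at 2 and -2 doubles the even indices and cancels the odd
  -- ones.
  g : ℕ → ℚ
  g j = 2ℚ ↑ j * Hₓ -1ℚ j + -2ℚ ↑ j * Hₓ -1ℚ j

  g-even : ∀ k → g (2 ℕ.* k) ≡ 2ℚ * (ℕ→ℚ 4 ↑ k * Hₓ -1ℚ (2 ℕ.* k))
  g-even k = trans (cong₂ (λ u v → u * Hₓ -1ℚ (2 ℕ.* k) + v * Hₓ -1ℚ (2 ℕ.* k)) (↑-2* 2ℚ k) (↑-2* -2ℚ k))
    (solve 1 (λ x → x :+ x := con 2ℚ :* x) refl (ℕ→ℚ 4 ↑ k * Hₓ -1ℚ (2 ℕ.* k)))

  g-odd : ∀ k → g (suc (2 ℕ.* k)) ≡ 0ℚ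
  g-odd k = trans (cong₂ (λ u v → 2ℚ * u * h + -2ℚ * v * h) (↑-2* 2ℚ k) (↑-2* -2ℚ k))
    (solve 2 (λ x h → con 2ℚ :* x :* h :+ con -2ℚ :* x :* h := con 0ℚ) refl (ℕ→ℚ 4 ↑ k) h)
    where
    h : ℚ
    h = Hₓ -1ℚ (suc (2 ℕ.* k))

  2*term : ∀ k → 2 ℕ.* k ≤ n →
    2ℚ * term k ≋ binom n (2 ℕ.* k) * g (2 ℕ.* k) + binom n (suc (2 ℕ.* k)) * g (suc (2 ℕ.* k))
  2*term k 2k≤n = ≋-trans (≡⇒≋ (begin
      2ℚ * term k
        ≡⟨ cong₂ (λ i b → 2ℚ * (i * b * (ℕ→ℚ 2 * H (2 ℕ.* k) - H k))) (inv-4^ k) (cong (λ m → binom m (2 ℕ.* k)) (ℕₚ.*-assoc 2 2 k)) ⟩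
      2ℚ * (inv 4 ↑ k * binom (2 ℕ.* (2 ℕ.* k)) (2 ℕ.* k) * (ℕ→ℚ 2 * H (2 ℕ.* k) - H k)) ∎))
    (≋-trans (≋-*ˡ (Local-ℕ 2) (≋-*ʳ Local-h (≋-*ˡ (Local-↑ k (Local-* Local-½ Local-½)) (central-binom-≋ (2 ℕ.* k) 2k≤n))))
    (≡⇒≋ (begin
      2ℚ * (inv 4 ↑ k * (-4ℚ ↑ (2 ℕ.* k) * b) * (ℕ→ℚ 2 * H (2 ℕ.* k) - H k))
        ≡⟨ cong₂ (λ x h → 2ℚ * (inv 4 ↑ k * (x * b) * h)) (trans (↑-2* -4ℚ k) (↑-distrib (ℕ→ℚ 4) (ℕ→ℚ 4) k)) (sym (Hₓ-1-even k)) ⟩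
      2ℚ * (inv 4 ↑ k * (X * X * b) * h)
        ≡⟨ solve 4 (λ i X b h → con 2ℚ :* (i :* (X :* X :* b) :* h) := i :* X :* (b :* (con 2ℚ :* (X :* h)))) refl (inv 4 ↑ k) X b h ⟩
      inv 4 ↑ k * X * (b * (2ℚ * (X * h)))
        ≡⟨ cong₂ (λ u v → u * (b * v)) (↑-inverse {inv 4} refl k) (sym (g-even k)) ⟩
      1ℚ * (b * g (2 ℕ.* k))
        -- The vanishing odd-index term is put in so that the summands become pairs of consecutive
        -- indices of a full transform.
        ≡⟨ solve 2 (λ x c → con 1ℚ :* x := x :+ c :* con 0ℚ) refl (b * g (2 ℕ.* k)) b′ ⟩
      b * g (2 ℕ.* k) + b′ * 0ℚ
        ≡⟨ cong (λ z → b * g (2 ℕ.* k) + b′ * z) (g-odd k) ⟨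
      b * g (2 ℕ.* k) + b′ * g (suc (2 ℕ.* k)) ∎)))
    where
    open ≡-Reasoning
    X b b′ h : ℚ
    X = ℕ→ℚ 4 ↑ k
    b = binom n (2 ℕ.* k)
    b′ = binom n (suc (2 ℕ.* k))
    h = Hₓ -1ℚ (2 ℕ.* k)
    Local-h : Local (ℕ→ℚ 2 * H (2 ℕ.* k) - H k)
    Local-h = Local-- (Local-* (Local-ℕ 2) (Local-H (2 ℕ.* k) (ℕₚ.≤-trans 2k≤n n≤2n)))
      (Local-H k (ℕₚ.≤-trans (ℕₚ.m≤m+n k (k ℕ.+ 0)) (ℕₚ.≤-trans 2k≤n n≤2n)))

  -- The bounds say that N is the floor of n/2: the first keeps all indices 2k within reach of
  -- `central-binom-≋`, the second makes the pairs exhaust row n.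
  sum-term : ∀ {N} → 2 ℕ.* N ≤ n → n < 2 ℕ.* suc N →
    2ℚ * sumRange 1 N term ≋ ℕ→ℚ 3 ↑ n * Hₓ -⅓ n + -1ℚ ↑ n * Hₓ -3ℚ n
  sum-term {N} 2N≤n n<2N+2 = ≋-trans
    -- `term 0` computes to 0, so the range may start at 0.
    (≡⇒≋ (trans (cong (2ℚ *_) (sym (ℚₚ.+-identityˡ (sumRange 1 N term)))) (sym (sumRange-* 2ℚ (suc N) term))))
    (≋-trans (≋-sumRange (suc N) λ { k (s≤s k≤N) → 2*term k (ℕₚ.≤-trans (ℕₚ.*-monoʳ-≤ 2 k≤N) 2N≤n) })
    (≡⇒≋ (begin
      sumRange 0 (suc N) (λ k → binom n (2 ℕ.* k) * g (2 ℕ.* k) + binom n (suc (2 ℕ.* k)) * g (suc (2 ℕ.* k)))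
        ≡⟨ sumRange-pairs (suc N) (λ j → binom n j * g j) ⟨
      sumRange 0 (2 ℕ.* suc N) (λ j → binom n j * g j)
        ≡⟨ B-sumRange n (2 ℕ.* suc N) g n<2N+2 ⟩
      B n g
        ≡⟨ B-+ n (λ j → 2ℚ ↑ j * Hₓ -1ℚ j) (λ j → -2ℚ ↑ j * Hₓ -1ℚ j) ⟩
      B n (λ j → 2ℚ ↑ j * Hₓ -1ℚ j) + B n (λ j → -2ℚ ↑ j * Hₓ -1ℚ j)
        ≡⟨ cong₂ _+_ (B-Hₓ 2ℚ -1ℚ -⅓ refl n) (B-Hₓ -2ℚ -1ℚ -3ℚ refl n) ⟩
      ℕ→ℚ 3 ↑ n * Hₓ -⅓ n + -1ℚ ↑ n * Hₓ -3ℚ n ∎)))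
    where open ≡-Reasoning

  -- Comparison with the Fermat quotient

  p-cancel : ∀ {x y} → ℕ→ℚ p * x ≡ ℕ→ℚ p * y → x ≡ y
  p-cancel {x} {y} eq = trans (sym (inv-cancel (2 ℕ.* n) x)) (trans (cong (inv p *_) eq) (inv-cancel (2 ℕ.* n) y))

  module _ {ε : ℚ} (ε² : ε * ε ≡ 1ℚ) (Local-ε : Local ε)
           (E-3 : E -3ℚ p ≡ ℕ→ℚ 4 ↑ n) (E-⅓ : -3ℚ ↑ n * E -⅓ p ≡ ε * ℕ→ℚ 4 ↑ n) where
    open ≡-Reasoning

    -- `w` is the Euler quotient ((-3)^n - ε)/p, written through `F` so that its locality can be
    -- read off.
    q X w : ℚ
    q = fermatQuotient p 3
    X = -3ℚ ↑ n
    w = ε * F 1ℚ - X * F -⅓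

    E-1-p : E 1ℚ p ≡ ℕ→ℚ 4 ↑ n
    E-1-p = trans (E-1 (2 ℕ.* n)) (↑-2* 2ℚ n)

    Hₓ-3≋0 : Hₓ -3ℚ n ≋ 0ℚ
    Hₓ-3≋0 = ≋-trans (Hₓ≋F (Local-ℤ (ℤ.- ℤ.+ 3))) (≡⇒≋ (begin
      2ℚ * (F -3ℚ - F 1ℚ)
        ≡⟨ cong (λ z → 2ℚ * (z - F 1ℚ)) (p-cancel (trans (p*F -3ℚ) (trans (cong (_- 1ℚ) (trans E-3 (sym E-1-p))) (sym (p*F 1ℚ))))) ⟩
      2ℚ * (F 1ℚ - F 1ℚ)
        ≡⟨ cong (2ℚ *_) (ℚₚ.+-inverseʳ (F 1ℚ)) ⟩
      0ℚ ∎))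

    -- The 4^n parts of ε E(1) and (-3)^n E(-1/3) cancel, and only the constants subtracted in `p*F`
    -- remain. In particular this yields Euler's criterion (-3)^n ≡ ε.
    p*w : ℕ→ℚ p * w ≡ X - ε
    p*w = begin
      P * w
        ≡⟨ solve 5 (λ P ε f X g → P :* (ε :* f :- X :* g) := ε :* (P :* f) :- X :* (P :* g)) refl P ε (F 1ℚ) X (F -⅓) ⟩
      ε * (P * F 1ℚ) - X * (P * F -⅓)
        ≡⟨ cong₂ (λ u v → ε * u - X * v) (p*F 1ℚ) (p*F -⅓) ⟩
      ε * (E 1ℚ p - 1ℚ) - X * (E -⅓ p - 1ℚ)
        ≡⟨ solve 4 (λ ε e X e′ → ε :* (e :- con 1ℚ) :- X :* (e′ :- con 1ℚ) := ε :* e :- X :* e′ :+ (X :- ε)) refl ε (E 1ℚ p) X (E -⅓ p) ⟩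
      ε * E 1ℚ p - X * E -⅓ p + (X - ε)
        ≡⟨ cong₂ (λ u v → ε * u - v + (X - ε)) E-1-p E-⅓ ⟩
      ε * ℕ→ℚ 4 ↑ n - ε * ℕ→ℚ 4 ↑ n + (X - ε)
        ≡⟨ solve 2 (λ a b → a :- a :+ b := b) refl (ε * ℕ→ℚ 4 ↑ n) (X - ε) ⟩
      X - ε ∎
      where
      P : ℚ
      P = ℕ→ℚ p

    -- Factor 9^n - 1 = X² - ε² = (X - ε)(X + ε) and divide by p. Hence q₃ ≡ 2 ε w; being exact, the
    -- identity also gives the locality of `q`.
    q≡w : q ≡ w * (2ℚ * ε + ℕ→ℚ p * w)
    q≡w = p-cancel (begin
      P * q                              ≡⟨ p*fermatQuotient (2 ℕ.* n) 3 ⟩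
      ℕ→ℚ 3 ↑ (2 ℕ.* n) - 1ℚ             ≡⟨ cong₂ _-_ (trans (↑-2* (ℕ→ℚ 3) n) (↑-distrib -3ℚ -3ℚ n)) (sym ε²) ⟩
      X * X - ε * ε                      ≡⟨ solve 2 (λ X ε → X :* X :- ε :* ε := (X :- ε) :* (con 2ℚ :* ε :+ (X :- ε))) refl X ε ⟩
      (X - ε) * (2ℚ * ε + (X - ε))       ≡⟨ cong (λ z → z * (2ℚ * ε + z)) p*w ⟨
      P * w * (2ℚ * ε + P * w)           ≡⟨ ℚₚ.*-assoc P w (2ℚ * ε + P * w) ⟩
      P * (w * (2ℚ * ε + P * w))         ∎)
      where
      P : ℚ
      P = ℕ→ℚ p

    Local-X : Local X
    Local-X = Local-↑ n (Local-ℤ (ℤ.- ℤ.+ 3))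

    Local-w : Local w
    Local-w = Local-- (Local-* Local-ε (Local-F (Local-ℕ 1))) (Local-* Local-X (Local-F Local-⅓))

    Local-q : Local q
    Local-q = subst Local (sym q≡w) (Local-* Local-w (Local-+ (Local-* (Local-ℕ 2) Local-ε) (Local-* (Local-ℕ p) Local-w)))

    -- Replacing X by ε in front of F(1) turns 2X (F(-1/3) - F(1)) into -2w, and ε q₃ ≡ 2w because
    -- ε² = 1. The witness collects the two errors: ε w² from `q≡w`, and -2 w F(1) from replacing X.
    X*Hₓ-⅓≋ : X * Hₓ -⅓ n ≋ - (ε * q)
    X*Hₓ-⅓≋ = ≋-trans (≋-*ˡ Local-X (Hₓ≋F Local-⅓)) (cong-by (ε * (w * w) - 2ℚ * (w * f))
        (Local-- (Local-* Local-ε (Local-* Local-w Local-w)) (Local-* (Local-ℕ 2) (Local-* Local-w (Local-F (Local-ℕ 1))))) (begin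
      X * (2ℚ * (f′ - f)) - - (ε * q)
        ≡⟨ cong (λ z → X * (2ℚ * (f′ - f)) - - (ε * z)) q≡w ⟩
      X * (2ℚ * (f′ - f)) - - (ε * (w * (2ℚ * ε + P * w)))
        ≡⟨ solve 6 (λ X f′ f ε w P → X :* (con 2ℚ :* (f′ :- f)) :- :- (ε :* (w :* (con 2ℚ :* ε :+ P :* w)))
              := X :* (con 2ℚ :* (f′ :- f)) :+ con 2ℚ :* w :* (ε :* ε) :+ P :* (ε :* (w :* w))) refl X f′ f ε w P ⟩
      X * (2ℚ * (f′ - f)) + 2ℚ * w * (ε * ε) + P * (ε * (w * w))
        ≡⟨ cong (λ z → X * (2ℚ * (f′ - f)) + 2ℚ * w * z + P * (ε * (w * w))) ε² ⟩
      X * (2ℚ * (f′ - f)) + 2ℚ * w * 1ℚ + P * (ε * (w * w))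
        ≡⟨ solve 5 (λ X f′ f ε c → X :* (con 2ℚ :* (f′ :- f)) :+ con 2ℚ :* (ε :* f :- X :* f′) :* con 1ℚ :+ c
              := c :- con 2ℚ :* ((X :- ε) :* f)) refl X f′ f ε (P * (ε * (w * w))) ⟩
      P * (ε * (w * w)) - 2ℚ * ((X - ε) * f)
        ≡⟨ cong (λ z → P * (ε * (w * w)) - 2ℚ * (z * f)) p*w ⟨
      P * (ε * (w * w)) - 2ℚ * (P * w * f)
        ≡⟨ solve 4 (λ P ε w f → P :* (ε :* (w :* w)) :- con 2ℚ :* (P :* w :* f) := P :* (ε :* (w :* w) :- con 2ℚ :* (w :* f))) refl P ε w f ⟩
      P * (ε * (w * w) - 2ℚ * (w * f)) ∎))
      where
      P f f′ : ℚ
      P = ℕ→ℚ p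
      f = F 1ℚ
      f′ = F -⅓

    sum-C-H-mod : sumRange 0 (suc n) (λ k → binom (2 ℕ.* k) k * H k) ≡ - (ε * q) [modℚ p ]
    sum-C-H-mod = ≋⇒modℚ (≋-trans sum-binom-H X*Hₓ-⅓≋) (Local-neg (Local-* Local-ε Local-q))

    sum-term-mod : ∀ {N} → 2 ℕ.* N ≤ n → n < 2 ℕ.* suc N →
      sumRange 1 N term ≡ - (ε * (sgn n * q * ½)) [modℚ p ]
    sum-term-mod {N} 2N≤n n<2N+2 = ≋⇒modℚ {sumRange 1 N term}
      (≋-cancel 1 (p∤small (ℕₚ.<-≤-trans 1<n n≤2n))
      (≋-trans (sum-term 2N≤n n<2N+2)
      (≋-trans (≡⇒≋ (begin
        ℕ→ℚ 3 ↑ n * Hₓ -⅓ n + S * Hₓ -3ℚ n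
          -- The sign (-1)^((p-1)/2) of the second congruence arises here, from 3^n = (-1)^n (-3)^n.
          ≡⟨ cong (λ z → z * Hₓ -⅓ n + S * Hₓ -3ℚ n) (↑-distrib -1ℚ -3ℚ n) ⟩
        S * X * Hₓ -⅓ n + S * Hₓ -3ℚ n
          ≡⟨ cong (_+ S * Hₓ -3ℚ n) (ℚₚ.*-assoc S X (Hₓ -⅓ n)) ⟩
        S * (X * Hₓ -⅓ n) + S * Hₓ -3ℚ n ∎))
      (≋-trans (≋-+ (≋-*ˡ Local-S X*Hₓ-⅓≋) (≋-*ˡ Local-S Hₓ-3≋0))
      (≡⇒≋ (begin
        S * - (ε * q) + S * 0ℚ
          ≡⟨ solve 3 (λ S ε q → S :* (:- (ε :* q)) :+ S :* con 0ℚ := con 2ℚ :* :- (ε :* (S :* q :* con ½))) refl S ε q ⟩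
        2ℚ * - (ε * (S * q * ½))
          ≡⟨ cong (λ s → 2ℚ * - (ε * (s * q * ½))) (sgn-↑ n) ⟨
        2ℚ * - (ε * (sgn n * q * ½)) ∎))))))
      (Local-neg (Local-* Local-ε (Local-* (Local-* (subst Local (sym (sgn-↑ n)) Local-S) Local-q) Local-½)))
      where
      S : ℚ
      S = -1ℚ ↑ n
      Local-S : Local S
      Local-S = Local-↑ n (Local-ℤ (ℤ.- ℤ.+ 1))

-- Evaluation of E at −3 and −1/3

-- Steps of six suit both values of D: 1 + √-3 already has a rational cube, but 1 + 1/√-3 is 2/√3
-- times a primitive twelfth root of unity, whose first rational power is the sixth.
E-6+ : ∀ r k {D c} → (∀ m → E D (6 ℕ.+ m) ≡ c * E D m) → E D (r ℕ.* 6 ℕ.+ k) ≡ c ↑ r * E D k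
E-6+ zero    k {D}     eq = sym (ℚₚ.*-identityˡ (E D k))
E-6+ (suc r) k {D} {c} eq = trans (eq (r ℕ.* 6 ℕ.+ k))
  (trans (cong (c *_) (E-6+ r k eq)) (sym (ℚₚ.*-assoc c (c ↑ r) (E D k))))

E-3-6+ : ∀ m → E -3ℚ (6 ℕ.+ m) ≡ ℕ→ℚ 4 ↑ 3 * E -3ℚ m
E-3-6+ m = trans (E-3+ -3ℚ (3 ℕ.+ m)) (trans (cong₂ (λ e o → a * e + b * o) (E-3+ -3ℚ m) (O-3+ -3ℚ m))
  (solve 2 (λ e o → con a :* (con a :* e :+ con b :* o) :+ con b :* (con a :* o :+ con (ℕ→ℚ 3 + -3ℚ) :* e) := con (ℕ→ℚ 4 ↑ 3) :* e) refl (E -3ℚ m) (O -3ℚ m)))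
  where
  a b : ℚ
  a = 1ℚ + ℕ→ℚ 3 * -3ℚ
  b = -3ℚ * (ℕ→ℚ 3 + -3ℚ)

-- The sixth power of 1 + 1/√-3, that is (2/√3)^6 times -1.
-64/27 : ℚ
-64/27 = ℕ→ℚ 64 * - inv 27

E-⅓-6+ : ∀ m → E -⅓ (6 ℕ.+ m) ≡ -64/27 * E -⅓ m
E-⅓-6+ m = trans (E-3+ -⅓ (3 ℕ.+ m)) (trans (cong₂ (λ e o → a * e + b * o) (E-3+ -⅓ m) (O-3+ -⅓ m))
  (solve 2 (λ e o → con a :* (con a :* e :+ con b :* o) :+ con b :* (con a :* o :+ con (ℕ→ℚ 3 + -⅓) :* e) := con -64/27 :* e) refl (E -⅓ m) (O -⅓ m)))
  where
  a b : ℚ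
  a = 1ℚ + ℕ→ℚ 3 * -⅓
  b = -⅓ * (ℕ→ℚ 3 + -⅓)

6r+1 : ∀ r → suc (2 ℕ.* (3 ℕ.* r)) ≡ r ℕ.* 6 ℕ.+ 1
6r+1 = solve-∀

6r+5 : ∀ r → suc (2 ℕ.* (2 ℕ.+ 3 ℕ.* r)) ≡ r ℕ.* 6 ℕ.+ 5
6r+5 = solve-∀

E-3-6r+1 : ∀ r → E -3ℚ (suc (2 ℕ.* (3 ℕ.* r))) ≡ ℕ→ℚ 4 ↑ (3 ℕ.* r)
E-3-6r+1 r = trans (cong (E -3ℚ) (6r+1 r)) (trans (E-6+ r 1 E-3-6+)
  (trans (ℚₚ.*-identityʳ _) (↑-assoc (ℕ→ℚ 4) 3 r)))

E-3-6r+5 : ∀ r → E -3ℚ (suc (2 ℕ.* (2 ℕ.+ 3 ℕ.* r))) ≡ ℕ→ℚ 4 ↑ (2 ℕ.+ 3 ℕ.* r)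
E-3-6r+5 r = trans (cong (E -3ℚ) (6r+5 r)) (trans (E-6+ r 5 E-3-6+)
  (trans (cong (_* E -3ℚ 5) (↑-assoc (ℕ→ℚ 4) 3 r))
    (solve 1 (λ x → x :* con (E -3ℚ 5) := con (ℕ→ℚ 4) :* (con (ℕ→ℚ 4) :* x)) refl (ℕ→ℚ 4 ↑ (3 ℕ.* r)))))

-- Because (-3)^3 · (-64/27) = 64 = 4^3, the factor (-3)^n turns each step of six into one for 4^n.
-3↑*-64/27↑ : ∀ r → -3ℚ ↑ (3 ℕ.* r) * -64/27 ↑ r ≡ ℕ→ℚ 4 ↑ (3 ℕ.* r)
-3↑*-64/27↑ r = trans (cong (_* -64/27 ↑ r) (sym (↑-assoc -3ℚ 3 r)))
  (trans (sym (↑-distrib (-3ℚ ↑ 3) -64/27 r)) (↑-assoc (ℕ→ℚ 4) 3 r))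

E-⅓-6r+1 : ∀ r → -3ℚ ↑ (3 ℕ.* r) * E -⅓ (suc (2 ℕ.* (3 ℕ.* r))) ≡ 1ℚ * ℕ→ℚ 4 ↑ (3 ℕ.* r)
E-⅓-6r+1 r = begin
  x * E -⅓ (suc (2 ℕ.* (3 ℕ.* r)))   ≡⟨ cong (x *_) (trans (cong (E -⅓) (6r+1 r)) (E-6+ r 1 E-⅓-6+)) ⟩
  x * (y * 1ℚ)                       ≡⟨ solve 2 (λ x y → x :* (y :* con 1ℚ) := con 1ℚ :* (x :* y)) refl x y ⟩
  1ℚ * (x * y)                       ≡⟨ cong (1ℚ *_) (-3↑*-64/27↑ r) ⟩
  1ℚ * ℕ→ℚ 4 ↑ (3 ℕ.* r)             ∎
  where
  open ≡-Reasoning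
  x y : ℚ
  x = -3ℚ ↑ (3 ℕ.* r)
  y = -64/27 ↑ r

E-⅓-6r+5 : ∀ r → -3ℚ ↑ (2 ℕ.+ 3 ℕ.* r) * E -⅓ (suc (2 ℕ.* (2 ℕ.+ 3 ℕ.* r))) ≡ -1ℚ * ℕ→ℚ 4 ↑ (2 ℕ.+ 3 ℕ.* r)
E-⅓-6r+5 r = begin
  -3ℚ * (-3ℚ * x) * E -⅓ (suc (2 ℕ.* (2 ℕ.+ 3 ℕ.* r)))
    ≡⟨ cong (-3ℚ * (-3ℚ * x) *_) (trans (cong (E -⅓) (6r+5 r)) (E-6+ r 5 E-⅓-6+)) ⟩
  -3ℚ * (-3ℚ * x) * (y * E -⅓ 5)
    -- The sign comes from E(-1/3) at exponent 5: 1 - 10/3 + 5/9 = -16/9, and 9 · (-16/9) = -4².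
    ≡⟨ solve 2 (λ x y → con -3ℚ :* (con -3ℚ :* x) :* (y :* con (E -⅓ 5)) := con -1ℚ :* (con (ℕ→ℚ 4) :* (con (ℕ→ℚ 4) :* (x :* y)))) refl x y ⟩
  -1ℚ * (ℕ→ℚ 4 * (ℕ→ℚ 4 * (x * y)))
    ≡⟨ cong (λ z → -1ℚ * (ℕ→ℚ 4 * (ℕ→ℚ 4 * z))) (-3↑*-64/27↑ r) ⟩
  -1ℚ * ℕ→ℚ 4 ↑ (2 ℕ.+ 3 ℕ.* r) ∎
  where
  open ≡-Reasoning
  x y : ℚ
  x = -3ℚ ↑ (3 ℕ.* r)
  y = -64/27 ↑ r

-- p is odd and ε is the Legendre symbol of −3 modulo p; in terms of √−3, the
-- hypotheses evaluate the rational part of (1 + √−3) ^ p and of (1 + 1/√−3) ^ p.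
data Legendre-3 : ℕ → ℤ → Set where
  legendre : ∀ n {ε} → ℤ→ℚ ε * ℤ→ℚ ε ≡ 1ℚ → E -3ℚ (suc (2 ℕ.* n)) ≡ ℕ→ℚ 4 ↑ n →
    -3ℚ ↑ n * E -⅓ (suc (2 ℕ.* n)) ≡ ℤ→ℚ ε * ℕ→ℚ 4 ↑ n → Legendre-3 (suc (2 ℕ.* n)) ε

p%6≡1⇒Legendre : ∀ p → p % 6 ≡ 1 → Legendre-3 p (ℤ.+ 1)
p%6≡1⇒Legendre p p%6≡1 = subst (λ m → Legendre-3 m (ℤ.+ 1))
  (sym (trans (m≡m%n+[m/n]*n p 6) (trans (cong (ℕ._+ p /ₙ 6 ℕ.* 6) p%6≡1) (1+6r (p /ₙ 6)))))
  (legendre (3 ℕ.* (p /ₙ 6)) refl (E-3-6r+1 (p /ₙ 6)) (E-⅓-6r+1 (p /ₙ 6)))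
  where
  1+6r : ∀ r → 1 ℕ.+ r ℕ.* 6 ≡ suc (2 ℕ.* (3 ℕ.* r))
  1+6r = solve-∀

p%6≡5⇒Legendre : ∀ p → p % 6 ≡ 5 → Legendre-3 p (ℤ.- ℤ.+ 1)
p%6≡5⇒Legendre p p%6≡5 = subst (λ m → Legendre-3 m (ℤ.- ℤ.+ 1))
  (sym (trans (m≡m%n+[m/n]*n p 6) (trans (cong (ℕ._+ p /ₙ 6 ℕ.* 6) p%6≡5) (5+6r (p /ₙ 6)))))
  (legendre (2 ℕ.+ 3 ℕ.* (p /ₙ 6)) refl (E-3-6r+5 (p /ₙ 6)) (E-⅓-6r+5 (p /ₙ 6)))
  where
  5+6r : ∀ r → 5 ℕ.+ r ℕ.* 6 ≡ suc (2 ℕ.* (2 ℕ.+ 3 ℕ.* r))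
  5+6r = solve-∀

-- Residues modulo 6 and index bounds

prime%6 : ∀ {p} → Prime p → 5 ≤ p → p % 6 ≡ 1 ⊎ p % 6 ≡ 5
prime%6 {p} p-prime 5≤p = go (p % 6) refl (m%n<n p 6)
  where
  ∤p : ∀ {d} → 1 < d → d < 5 → ¬ d ∣ p
  ∤p 1<d d<5 d∣p with prime⇒irreducible p-prime d∣p
  ... | inj₁ refl = ℕₚ.<-irrefl refl 1<d
  ... | inj₂ refl = ℕₚ.<⇒≱ d<5 5≤p

  2∤p%6 : ¬ 2 ∣ p % 6
  2∤p%6 2∣c = ∤p (s≤s (s≤s z≤n)) (s≤s (s≤s (s≤s z≤n)))
    (m%n≡0⇒n∣m p 2 (trans (sym (m∣n⇒o%n%m≡o%m 2 6 p (divides 3 refl))) (n∣m⇒m%n≡0 (p % 6) 2 2∣c)))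

  3∤p%6 : ¬ 3 ∣ p % 6
  3∤p%6 3∣c = ∤p (s≤s (s≤s z≤n)) (s≤s (s≤s (s≤s (s≤s z≤n))))
    (m%n≡0⇒n∣m p 3 (trans (sym (m∣n⇒o%n%m≡o%m 3 6 p (divides 2 refl))) (n∣m⇒m%n≡0 (p % 6) 3 3∣c)))

  go : ∀ c → p % 6 ≡ c → c < 6 → p % 6 ≡ 1 ⊎ p % 6 ≡ 5
  go 0 eq _ = contradiction (subst (2 ∣_) (sym eq) (divides 0 refl)) 2∤p%6
  go 1 eq _ = inj₁ eq
  go 2 eq _ = contradiction (subst (2 ∣_) (sym eq) (divides 1 refl)) 2∤p%6
  go 3 eq _ = contradiction (subst (3 ∣_) (sym eq) (divides 1 refl)) 3∤p%6
  go 4 eq _ = contradiction (subst (2 ∣_) (sym eq) (divides 2 refl)) 2∤p%6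
  go 5 eq _ = inj₂ eq
  go (suc (suc (suc (suc (suc (suc _)))))) _ (s≤s (s≤s (s≤s (s≤s (s≤s (s≤s ()))))))

p%3≡p%6%3 : ∀ p {c} → p % 6 ≡ c → p % 3 ≡ c % 3
p%3≡p%6%3 p eq = trans (sym (m∣n⇒o%n%m≡o%m 3 6 p (divides 2 refl))) (cong (_% 3) eq)

p%3≡1⇒p%6≡1 : ∀ {p} → Prime p → 5 ≤ p → p % 3 ≡ 1 → p % 6 ≡ 1
p%3≡1⇒p%6≡1 {p} p-prime 5≤p p%3≡1 =
  [ (λ eq → eq) , (λ eq → contradiction (trans (sym p%3≡1) (p%3≡p%6%3 p eq)) λ ()) ]′ (prime%6 p-prime 5≤p)

p%3≡2⇒p%6≡5 : ∀ {p} → Prime p → 5 ≤ p → p % 3 ≡ 2 → p % 6 ≡ 5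
p%3≡2⇒p%6≡5 {p} p-prime 5≤p p%3≡2 =
  [ (λ eq → contradiction (trans (sym p%3≡2) (p%3≡p%6%3 p eq)) λ ()) , (λ eq → eq) ]′ (prime%6 p-prime 5≤p)

1<n : ∀ {n} → 5 ≤ suc (2 ℕ.* n) → 1 < n
1<n 5≤p = ℕₚ.*-cancelˡ-≤ 2 (ℕₚ.≤-pred 5≤p)

2n/2≡n : ∀ n → 2 ℕ.* n /ₙ 2 ≡ n
2n/2≡n n = trans (cong (_/ₙ 2) (ℕₚ.*-comm 2 n)) (m*n/n≡m n 2)

2*[n/2]≤n : ∀ n → 2 ℕ.* (n /ₙ 2) ≤ n
2*[n/2]≤n n = subst (_≤ n) (ℕₚ.*-comm (n /ₙ 2) 2) (m/n*n≤m n 2)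

n<2*suc[n/2] : ∀ n → n < 2 ℕ.* suc (n /ₙ 2)
n<2*suc[n/2] n = begin-strict
  n                           ≡⟨ m≡m%n+[m/n]*n n 2 ⟩
  n % 2 ℕ.+ n /ₙ 2 ℕ.* 2      <⟨ ℕₚ.+-monoˡ-< (n /ₙ 2 ℕ.* 2) (m%n<n n 2) ⟩
  suc (n /ₙ 2) ℕ.* 2          ≡⟨ ℕₚ.*-comm (suc (n /ₙ 2)) 2 ⟩
  2 ℕ.* suc (n /ₙ 2)          ∎
  where open ℕₚ.≤-Reasoning

-- The congruences in terms of p

sum-C-H : ∀ {p ε y} → Prime p → 5 ≤ p → Legendre-3 p ε → - (ℤ→ℚ ε * fermatQuotient p 3) ≡ y →
  Σ[ 0 ⋯ (p ∸ 1) /ₙ 2 ] (λ k → ℕ→ℚ ((2 *ₙ k) C k) * H k) ≡ y [modℚ p ]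
sum-C-H {ε = ε} p-prime 5≤p (legendre n ε² E-3 E-⅓) refl = subst
  (λ N → Σ[ 0 ⋯ N ] (λ k → ℕ→ℚ ((2 *ₙ k) C k) * H k) ≡ - (ℤ→ℚ ε * fermatQuotient (suc (2 ℕ.* n)) 3) [modℚ suc (2 ℕ.* n) ])
  (sym (2n/2≡n n)) (OddPrime.sum-C-H-mod {n} p-prime (1<n {n} 5≤p) ε² (Localization.Local-ℤ p-prime ε) E-3 E-⅓)

sum-C-2H-H : ∀ {p ε y} → Prime p → 5 ≤ p → Legendre-3 p ε →
  - (ℤ→ℚ ε * (sgn ((p ∸ 1) /ₙ 2) * fermatQuotient p 3 * ½)) ≡ y →
  Σ[ 1 ⋯ (p ∸ 1) /ₙ 4 ] (λ k → inv (4 ^ k) * ℕ→ℚ ((4 *ₙ k) C (2 *ₙ k)) * (ℕ→ℚ 2 * H (2 *ₙ k) - H k)) ≡ y [modℚ p ]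
sum-C-2H-H {ε = ε} p-prime 5≤p (legendre n ε² E-3 E-⅓) refl = subst₂
  (λ M N → Σ[ 1 ⋯ N ] (λ k → inv (4 ^ k) * ℕ→ℚ ((4 *ₙ k) C (2 *ₙ k)) * (ℕ→ℚ 2 * H (2 *ₙ k) - H k))
    ≡ - (ℤ→ℚ ε * (sgn M * fermatQuotient (suc (2 ℕ.* n)) 3 * ½)) [modℚ suc (2 ℕ.* n) ])
  -- With p - 1 = 2n and 4 = 2 · 2, the upper limit ⌊(p - 1)/4⌋ is ⌊n/2⌋.
  (sym (2n/2≡n n)) (sym (m*n/m*o≡n/o 2 n 2))
  (OddPrime.sum-term-mod {n} p-prime (1<n {n} 5≤p) ε² (Localization.Local-ℤ p-prime ε) E-3 E-⅓ (2*[n/2]≤n n) (n<2*suc[n/2] n))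

-‿*1 : ∀ x → - (1ℚ * x) ≡ - x
-‿*1 x = cong -_ (ℚₚ.*-identityˡ x)

-‿*-1 : ∀ x → - (-1ℚ * x) ≡ x
-‿*-1 = solve 1 (λ x → :- (con -1ℚ :* x) := x) refl

theorem2 : (p : ℕ) → Prime p → 5 ≤ p →
    ((p % 3 ≡ 1 →
    Σ[ 0 ⋯ (p ∸ 1) /ₙ 2 ] (λ k → ℕ→ℚ ((2 *ₙ k) C k) * H k)
    ≡ - fermatQuotient p 3 [modℚ p ])
    × (p % 3 ≡ 2 →
    Σ[ 0 ⋯ (p ∸ 1) /ₙ 2 ] (λ k → ℕ→ℚ ((2 *ₙ k) C k) * H k)
    ≡ fermatQuotient p 3 [modℚ p ]))
    × ((p % 6 ≡ 1 →
    Σ[ 1 ⋯ (p ∸ 1) /ₙ 4 ] (λ k → inv (4 ^ k) * ℕ→ℚ ((4 *ₙ k) C (2 *ₙ k)) * (ℕ→ℚ 2 * H (2 *ₙ k) - H k))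
    ≡ - (sgn ((p ∸ 1) /ₙ 2) * fermatQuotient p 3 * ½) [modℚ p ])
    × (p % 6 ≡ 5 →
    Σ[ 1 ⋯ (p ∸ 1) /ₙ 4 ] (λ k → inv (4 ^ k) * ℕ→ℚ ((4 *ₙ k) C (2 *ₙ k)) * (ℕ→ℚ 2 * H (2 *ₙ k) - H k))
    ≡ sgn ((p ∸ 1) /ₙ 2) * fermatQuotient p 3 * ½ [modℚ p ]))
theorem2 p p-prime 5≤p =
  ((λ p%3≡1 → sum-C-H p-prime 5≤p (p%6≡1⇒Legendre p (p%3≡1⇒p%6≡1 p-prime 5≤p p%3≡1)) (-‿*1 q))
  , (λ p%3≡2 → sum-C-H p-prime 5≤p (p%6≡5⇒Legendre p (p%3≡2⇒p%6≡5 p-prime 5≤p p%3≡2)) (-‿*-1 q)))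
  , ((λ p%6≡1 → sum-C-2H-H p-prime 5≤p (p%6≡1⇒Legendre p p%6≡1) (-‿*1 (sgn ((p ∸ 1) /ₙ 2) * q * ½)))
  , (λ p%6≡5 → sum-C-2H-H p-prime 5≤p (p%6≡5⇒Legendre p p%6≡5) (-‿*-1 (sgn ((p ∸ 1) /ₙ 2) * q * ½))))
  where
  q : ℚ
  q = fermatQuotient p 3
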